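{- Define $a_k=k(k-1)$ for $k\ge 2$ and $a_1=-1$. For every integer $n\ge1$, the polynomial $A_{n,2}(x)$ is given by $$A_{n,2}(x)=\frac{1}{i\,n!}\sum_{k=1}^{n}\frac{x^k}{a_k}\left[(x+i)^{n-k+1}-(x-i)^{n-k+1}\right],$$ and this can be written as $$A_{n,2}(x)=\frac{1}{n!}\sum_{k=1}^{n}\frac{(n-k+1)!}{a_k}\,x^k B_{n-k+1,2}(x).$$
   Context: Let $f_0(x)=\ln(1+x^2)$ and $f_n(x)=\int_0^x f_{n-1}(t)\,dt$ for $n\ge1$ ($x$ real). For each $n\ge 0$, $A_{n,2},B_{n,2},C_{n,2}$ denote the (uniquely determined) polynomials with $$f_n(x)=A_{n,2}(x)+B_{n,2}(x)\arctan x+C_{n,2}(x)\ln(1+x^2).$$ Here $i=\sqrt{ -1}$. -}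

module Defs where

open import Level using (Level; suc; _⊔_)
open import Data.Empty using (⊥-elim)
open import Data.Nat.Base as ℕ using (ℕ; NonZero; _!; _∸_)
open import Data.Nat.Properties using (_!≢0)
open import Data.Fin.Base using (Fin; inject₁; fromℕ)
open import Data.List.Base using (List; foldr)
open import Data.Product.Base using (_×_; _,_; proj₁; ∃; ∃-syntax)
open import Data.Sum.Base using (_⊎_; inj₁; inj₂)
open import Relation.Nullary.Negation using (¬_)
open import Relation.Binary.Core using (Rel)
open import Relation.Binary.Structures using (IsStrictPartialOrder)
open import Algebra.Bundles using (CommutativeRing; RawRing)
open import Algebra.Apartness.Bundles using (HeytingField; HeytingCommutativeRing)
import Algebra.Definitions.RawSemiring
import Algebra.Properties.Ring

-- The real numbers, axiomatised as a Cauchy-complete Archimedean ordered field.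
-- Classically these axioms determine ℝ up to a unique isomorphism.  They are
-- phrased (apartness, order not assumed decidable) so that constructive models
-- of ℝ satisfy them as well.

record RealField (c ℓ₁ ℓ₂ : Level) : Set (suc (c ⊔ ℓ₁ ⊔ ℓ₂)) where
  infix 4 _<_ _≤_
  infix 4 ∣_∣<_
  field
    heytingField : HeytingField c ℓ₁ ℓ₂

  open HeytingField heytingField public

  open HeytingCommutativeRing heytingCommutativeRing public using (commutativeRing)

  open CommutativeRing commutativeRing public using (rawRing; ring)

  open RawRing rawRing public using (rawSemiring)

  open Algebra.Definitions.RawSemiring rawSemiring public
    using (_^_; sum) renaming (_×_ to _×ℕ_)

  fromNat : ℕ → Carrier
  fromNat n = n ×ℕ 1#

  field
    _<_                  : Rel Carrier ℓ₂
    isStrictPartialOrder : IsStrictPartialOrder _≈_ _<_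
    <⇒#                  : ∀ {x y} → x < y → x # y
    #⇒<⊎>                : ∀ {x y} → x # y → x < y ⊎ y < x
    0<1                  : 0# < 1#
    +-monoˡ-<            : ∀ z {x y} → x < y → x + z < y + z
    *-pos                : ∀ {x y} → 0# < x → 0# < y → 0# < x * y
    archimedean          : ∀ x → ∃[ n ] x < fromNat n

  _≤_ : Rel Carrier ℓ₂
  x ≤ y = ¬ (y < x)

  -- |x| < ε
  ∣_∣<_ : Rel Carrier ℓ₂
  ∣ x ∣< ε = (- ε < x) × (x < ε)

  Cauchy : (ℕ → Carrier) → Set (c ⊔ ℓ₂)
  Cauchy s = ∀ ε → 0# < ε → ∃[ N ] (∀ m n → N ℕ.≤ m → N ℕ.≤ n → ∣ s m - s n ∣< ε)

  _⟶_ : (ℕ → Carrier) → Carrier → Set (c ⊔ ℓ₂)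
  s ⟶ l = ∀ ε → 0# < ε → ∃[ N ] (∀ n → N ℕ.≤ n → ∣ s n - l ∣< ε)

  field
    complete : ∀ s → Cauchy s → ∃[ l ] s ⟶ l

module Analysis {c ℓ₁ ℓ₂ : Level} (ℝ : RealField c ℓ₁ ℓ₂) where

  open RealField ℝ public
  open IsStrictPartialOrder isStrictPartialOrder public
    using (<-respˡ-≈; <-respʳ-≈) renaming (irrefl to <-irrefl; trans to <-trans)
  open Algebra.Properties.Ring ring
    using (-‿distribˡ-*; -‿distribʳ-*; -‿involutive; -0#≈0#)

  <-≤-trans : ∀ {x y z} → x < y → y ≤ z → x < z
  <-≤-trans {z = z} x<y y≤z with #-cotrans (<⇒# x<y) z
  ... | inj₁ x#z with #⇒<⊎> x#z
  ...   | inj₁ x<z = x<z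
  ...   | inj₂ z<x = ⊥-elim (y≤z (<-trans z<x x<y))
  <-≤-trans {z = z} x<y y≤z | inj₂ z#y with #⇒<⊎> z#y
  ...   | inj₁ z<y = ⊥-elim (y≤z z<y)
  ...   | inj₂ y<z = <-trans x<y y<z

  neg⇒-pos : ∀ {x} → x < 0# → 0# < - x
  neg⇒-pos {x} x<0 =
    <-respˡ-≈ (-‿inverseʳ x) (<-respʳ-≈ (+-identityˡ (- x)) (+-monoˡ-< (- x) x<0))

  pos⇒-neg : ∀ {x} → 0# < x → - x < 0#
  pos⇒-neg {x} 0<x =
    <-respˡ-≈ (+-identityˡ (- x)) (<-respʳ-≈ (-‿inverseʳ x) (+-monoˡ-< (- x) 0<x))

  +-pos : ∀ {x y} → 0# < x → 0# < y → 0# < x + y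
  +-pos {x} {y} 0<x 0<y = <-trans 0<y (<-respˡ-≈ (+-identityˡ y) (+-monoˡ-< y 0<x))

  #0⇒0<x² : ∀ {x} → x # 0# → 0# < x * x
  #0⇒0<x² {x} x#0 with #⇒<⊎> x#0
  ... | inj₂ 0<x = *-pos 0<x 0<x
  ... | inj₁ x<0 = <-respʳ-≈ -x*-x≈x*x (*-pos (neg⇒-pos x<0) (neg⇒-pos x<0))
    where
    -x*-x≈x*x : - x * - x ≈ x * x
    -x*-x≈x*x = trans (sym (-‿distribˡ-* x (- x)))
      (trans (-‿cong (sym (-‿distribʳ-* x x))) (-‿involutive (x * x)))

  0≤x² : ∀ x → 0# ≤ x * x
  0≤x² x x²<0 = <-irrefl (trans (*-cong x≈0 refl) (zeroˡ x)) x²<0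
    where
    x≈0 : x ≈ 0#
    x≈0 = proj₁ (tight x 0#) (λ x#0 → <-irrefl refl (<-trans x²<0 (#0⇒0<x² x#0)))

  0<1+x² : ∀ x → 0# < 1# + x * x
  0<1+x² x = <-≤-trans 0<1 (λ 1+x²<1 → 0≤x² x
    (<-respˡ-≈ (cancel (x * x)) (<-respʳ-≈ (-‿inverseʳ 1#) (+-monoˡ-< (- 1#) 1+x²<1))))
    where
    cancel : ∀ y → 1# + y + - 1# ≈ y
    cancel y = trans (+-cong (+-comm 1# y) refl) (trans (+-assoc y 1# (- 1#))
      (trans (+-cong refl (-‿inverseʳ 1#)) (+-identityʳ y)))

  fromNat-pos : ∀ n .{{_ : NonZero n}} → 0# < fromNat n
  fromNat-pos 1                   = <-respʳ-≈ (sym (+-identityʳ 1#)) 0<1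
  fromNat-pos (ℕ.suc n@(ℕ.suc _)) = +-pos 0<1 (fromNat-pos n)

  pos⇒#0 : ∀ {x} → 0# < x → x # 0#
  pos⇒#0 0<x = #-sym (<⇒# 0<x)

  n!#0 : ∀ n → fromNat (n !) # 0#
  n!#0 n = pos⇒#0 (fromNat-pos (n !) {{n !≢0}})

  -- 1 / x.  The library inverts the difference x - 0#, which is ≈ x.
  recip : ∀ x → x # 0# → Carrier
  recip x x#0 = proj₁ (#⇒invertible x#0)

  -- Real polynomials as coefficient lists, constant term first.
  Polynomial : Set c
  Polynomial = List Carrier

  _⟨_⟩ : Polynomial → Carrier → Carrier
  p ⟨ x ⟩ = foldr (λ a r → a + x * r) 0# p

  record TaggedPartition (a b : Carrier) : Set (c ⊔ ℓ₁ ⊔ ℓ₂) where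
    field
      size      : ℕ
      point     : Fin (ℕ.suc size) → Carrier
      tag       : Fin size → Carrier
      first     : point Fin.zero ≈ a
      last      : point (fromℕ size) ≈ b
      point≤tag : ∀ i → point (inject₁ i) ≤ tag i
      tag≤point : ∀ i → tag i ≤ point (Fin.suc i)
      -- These two follow from the previous fields; they are kept as fields so
      -- that integrands defined only on [a , b] can be applied to the tags.
      a≤tag     : ∀ i → a ≤ tag i
      tag≤b     : ∀ i → tag i ≤ b

    width : Fin size → Carrier
    width i = point (Fin.suc i) - point (inject₁ i)

    riemannSum : (∀ t → a ≤ t → t ≤ b → Carrier) → Carrier
    riemannSum g = sum (λ i → g (tag i) (a≤tag i) (tag≤b i) * width i)

  -- For a ≤ b: the function g on [a , b] is Riemann integrable with integral I.
  IsRiemannIntegral : (a b : Carrier) → (∀ t → a ≤ t → t ≤ b → Carrier) →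
                      Carrier → Set (c ⊔ ℓ₁ ⊔ ℓ₂)
  IsRiemannIntegral a b g I =
    ∀ ε → 0# < ε → ∃[ δ ] (0# < δ × (∀ (P : TaggedPartition a b) →
      let open TaggedPartition P in
      (∀ i → width i < δ) → ∣ riemannSum g - I ∣< ε))

  -- ∫ₐᵇ g(t) dt = I for a and b in either order, with ∫ₐᵇ = - ∫ᵇₐ.
  -- Deciding a ≤ b is not possible constructively, hence the two implications.
  IsIntegral : (a b : Carrier) → (Carrier → Carrier) → Carrier → Set (c ⊔ ℓ₁ ⊔ ℓ₂)
  IsIntegral a b g I =
    (a ≤ b → IsRiemannIntegral a b (λ t _ _ → g t) I) ×
    (b ≤ a → IsRiemannIntegral b a (λ t _ _ → g t) (- I))

  -- ln y = ∫₁ʸ dt / t for 0 < y.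
  IsLn : ∀ y → 0# < y → Carrier → Set (c ⊔ ℓ₁ ⊔ ℓ₂)
  IsLn y 0<y I =
    (1# ≤ y → IsRiemannIntegral 1# y (λ t 1≤t _ → recip t (pos⇒#0 (<-≤-trans 0<1 1≤t))) I) ×
    (y ≤ 1# → IsRiemannIntegral y 1# (λ t y≤t _ → recip t (pos⇒#0 (<-≤-trans 0<y y≤t))) (- I))

  -- arctan x = ∫₀ˣ dt / (1 + t²).
  IsArctan : Carrier → Carrier → Set (c ⊔ ℓ₁ ⊔ ℓ₂)
  IsArctan x I = IsIntegral 0# x (λ t → recip (1# + t * t) (pos⇒#0 (0<1+x² t))) I

  a : (k : ℕ) .{{_ : NonZero k}} → Carrier
  a 1                   = - 1#
  a k@(ℕ.suc (ℕ.suc _)) = fromNat (k ℕ.* (k ∸ 1))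

  a#0 : ∀ k .{{_ : NonZero k}} → a k # 0#
  a#0 1                   = <⇒# (pos⇒-neg 0<1)
  a#0 k@(ℕ.suc (ℕ.suc _)) = pos⇒#0 (fromNat-pos (k ℕ.* (k ∸ 1)))

  record ℂ : Set c where
    constructor _+i_
    field
      re im : Carrier

  open ℂ public

  ofReal : Carrier → ℂ
  ofReal x = x +i 0#

  𝕚 : ℂ
  𝕚 = 0# +i 1#

  ℂ-rawRing : RawRing c ℓ₁
  ℂ-rawRing = record
    { Carrier = ℂ
    ; _≈_     = λ z w → (re z ≈ re w) × (im z ≈ im w)
    ; _+_     = λ z w → (re z + re w) +i (im z + im w)
    ; _*_     = λ z w → (re z * re w - im z * im w) +i (re z * im w + im z * re w)
    ; -_      = λ z → (- re z) +i (- im z)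
    ; 0#      = ofReal 0#
    ; 1#      = ofReal 1#
    }

  open RawRing ℂ-rawRing public using ()
    renaming (_≈_ to _≈ᶜ_; _+_ to _+ᶜ_; _*_ to _*ᶜ_; -_ to -ᶜ_; rawSemiring to ℂ-rawSemiring)

  open Algebra.Definitions.RawSemiring ℂ-rawSemiring public using ()
    renaming (_^_ to _^ᶜ_; sum to sumᶜ)

  infixl 6 _-ᶜ_
  _-ᶜ_ : ℂ → ℂ → ℂ
  z -ᶜ w = z +ᶜ (-ᶜ w)

  ∣_∣² : ℂ → Carrier
  ∣ z ∣² = re z * re z + im z * im z

  recipᶜ : ∀ z → ∣ z ∣² # 0# → ℂ
  recipᶜ z z≠0 = (re z * recip ∣ z ∣² z≠0) +i (- im z * recip ∣ z ∣² z≠0)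

  i*n!≠0 : ∀ n → ∣ 𝕚 *ᶜ ofReal (fromNat (n !)) ∣² # 0#
  i*n!≠0 n = pos⇒#0 (<-respʳ-≈ (sym normSq≈) (*-pos 0<r 0<r))
    where
    r = fromNat (n !)
    0<r : 0# < r
    0<r = fromNat-pos (n !) {{n !≢0}}
    re≈0 : 0# * r - 1# * 0# ≈ 0#
    re≈0 = trans (+-cong (zeroˡ r) (trans (-‿cong (zeroʳ 1#)) -0#≈0#)) (+-identityˡ 0#)
    im≈r : 0# * 0# + 1# * r ≈ r
    im≈r = trans (+-cong (zeroˡ 0#) (*-identityˡ r)) (+-identityˡ r)
    normSq≈ : ∣ 𝕚 *ᶜ ofReal r ∣² ≈ r * r
    normSq≈ = trans (+-cong (trans (*-cong re≈0 re≈0) (zeroˡ 0#)) (*-cong im≈r im≈r))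
      (+-identityˡ (r * r))

-- Let z = x + i and α_n = Σ_{k=1}^n x^k / a_k · 2 Im z^{n-k+1}.  The function
--   F_n = (α_n + 2 Im(z^n) arctan x + Re(z^n) ln(1 + x²)) / n!
-- vanishes at 0 and has derivative F_{n-1}, because α_n′ - n α_{n-1} telescopes
-- to - 2 Re z^{n-1}; hence f_n = F_n.
--
-- The polynomial coefficients are unique: let P + Q arctan x + R ln(1 + x²)
-- vanish identically and let p, q, r be the coefficients of x^d in P, Q, R, where
-- no higher power occurs.  At x = ± 4^k both arctan x and ln(1 + x²) are O(k), so
-- p + q arctan x + r ln(1 + x²) = O(k / 4^k).  Taking even and odd parts,
-- q arctan 4^k → 0 and p + r ln(1 + 16^k) → 0.  Since arctan 4^k ≥ arctan 1 > 0
-- and ln(1 + 16^{k+1}) - ln(1 + 16^k) ≥ 1/2, this gives q = r = p = 0.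

module Submission where

open import Defs
open import Level using (Level; _⊔_)
open import Algebra.Bundles using (CommutativeRing)
import Algebra.Apartness.Properties.HeytingCommutativeRing
import Algebra.Properties.AbelianGroup
import Algebra.Properties.Ring
import Algebra.Properties.Semiring.Mult
import Algebra.Properties.Semiring.Mult.TCOptimised as Mult
import Algebra.Solver.Ring
open import Algebra.Solver.Ring.AlmostCommutativeRing
  using (fromCommutativeRing; _-Raw-AlmostCommutative⟶_)
open import Data.Empty using (⊥-elim)
open import Data.Fin.Base using (Fin; inject₁; fromℕ; toℕ)
import Data.Fin.Properties as Fin
open import Data.Integer.Base as ℤ using (ℤ; +_; -[1+_]; _⊖_)
import Data.Integer.Properties as ℤ
open import Data.List.Base using ([]; _∷_)
open import Data.Maybe.Base using (Maybe; just; nothing)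
open import Data.Nat.Base as ℕ using (ℕ; suc; pred; _!; _∸_)
import Data.Nat.Properties as ℕ
open import Data.Product.Base using (_×_; _,_; proj₁; proj₂; ∃-syntax)
import Data.Sign.Base as Sign
open import Data.Sum.Base using (inj₁; inj₂)
import Relation.Binary.PropositionalEquality.Core as ≡
import Relation.Binary.Reasoning.Setoid
open import Relation.Nullary.Decidable using (yes; no)
open import Relation.Nullary.Negation using (¬_)

-- The order is not decidable and the integrals are hypotheses about given values, so every analytic
-- fact is an explicit inequality. A derivative is an estimate
-- `|F t - F s - G s (t - s)| ≤ K (t - s)²` for `s ≤ t`: on a bounded interval this form is stable
-- under sums and products, and added up over a left-tagged partition of mesh `η` the errors are at
-- most `K η (b - a)`. In the uniqueness argument both signs of the sample point matter: at `+∞`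
-- alone `arctan` tends to a constant, and `p` and `q` could not be separated. The points `4^k` suit
-- because each quadrupling changes `arctan x` and `ln(1 + x²)` by bounded amounts while
-- `(k + 1)² ≤ 4^k`; the Archimedean axiom then replaces all limits.

-- Integers as decidable coefficients for the ring solver

module IntegerCoefficients {c ℓ} (R : CommutativeRing c ℓ) where

  open CommutativeRing R
  open Mult semiring using (1+×; ×-homo-+; ×1-homo-*) renaming (_×_ to _⋆_)
  open Algebra.Properties.Ring ring
    using (-‿distribˡ-*; -‿distribʳ-*; -‿involutive; -0#≈0#)
  open Algebra.Properties.AbelianGroup +-abelianGroup using (⁻¹-∙-comm)
  open Relation.Binary.Reasoning.Setoid setoid

  -- This form of multiple sends 1 to `1#` itself, without a trailing `+ 0#`. Hence `1-homo` is
  -- `refl`, and `:2` denotes `1# + 1#` on the nose.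
  ⟦_⟧ℕ : ℕ → Carrier
  ⟦ n ⟧ℕ = n ⋆ 1#

  ⟦_⟧ℤ : ℤ → Carrier
  ⟦ + n      ⟧ℤ = ⟦ n ⟧ℕ
  ⟦ -[1+ n ] ⟧ℤ = - ⟦ suc n ⟧ℕ

  -‿homo : ∀ i → ⟦ ℤ.- i ⟧ℤ ≈ - ⟦ i ⟧ℤ
  -‿homo (+ 0)     = sym -0#≈0#
  -‿homo (+ suc n) = refl
  -‿homo -[1+ n ]  = sym (-‿involutive ⟦ suc n ⟧ℕ)

  cancel-1 : ∀ x y → (1# + x) - (1# + y) ≈ x - y
  cancel-1 x y = begin
    (1# + x) - (1# + y)      ≈⟨ +-congˡ (⁻¹-∙-comm 1# y) ⟨
    (1# + x) + (- 1# + - y)  ≈⟨ +-congʳ (+-comm 1# x) ⟩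
    (x + 1#) + (- 1# + - y)  ≈⟨ +-assoc x 1# _ ⟩
    x + (1# + (- 1# + - y))  ≈⟨ +-congˡ (+-assoc 1# (- 1#) (- y)) ⟨
    x + ((1# - 1#) + - y)    ≈⟨ +-congˡ (+-congʳ (-‿inverseʳ 1#)) ⟩
    x + (0# + - y)           ≈⟨ +-congˡ (+-identityˡ (- y)) ⟩
    x - y                    ∎

  ⊖-homo : ∀ m n → ⟦ m ⊖ n ⟧ℤ ≈ ⟦ m ⟧ℕ - ⟦ n ⟧ℕ
  ⊖-homo 0       0       = sym (-‿inverseʳ 0#)
  ⊖-homo 0       (suc n) = sym (+-identityˡ _)
  ⊖-homo (suc m) 0       = sym (trans (+-congˡ -0#≈0#) (+-identityʳ _))
  ⊖-homo (suc m) (suc n) = begin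
    ⟦ suc m ⊖ suc n ⟧ℤ               ≡⟨ ≡.cong ⟦_⟧ℤ (ℤ.[1+m]⊖[1+n]≡m⊖n m n) ⟩
    ⟦ m ⊖ n ⟧ℤ                       ≈⟨ ⊖-homo m n ⟩
    ⟦ m ⟧ℕ - ⟦ n ⟧ℕ                  ≈⟨ cancel-1 _ _ ⟨
    (1# + ⟦ m ⟧ℕ) - (1# + ⟦ n ⟧ℕ)    ≈⟨ +-cong (1+× m 1#) (-‿cong (1+× n 1#)) ⟨
    ⟦ suc m ⟧ℕ - ⟦ suc n ⟧ℕ          ∎

  +-homo : ∀ i j → ⟦ i ℤ.+ j ⟧ℤ ≈ ⟦ i ⟧ℤ + ⟦ j ⟧ℤ
  +-homo (+ m)    (+ n)    = ×-homo-+ 1# m n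
  +-homo (+ m)    -[1+ n ] = ⊖-homo m (suc n)
  +-homo -[1+ m ] (+ n)    = trans (⊖-homo n (suc m)) (+-comm _ _)
  +-homo -[1+ m ] -[1+ n ] = begin
    - ⟦ suc (suc (m ℕ.+ n)) ⟧ℕ     ≡⟨ ≡.cong (λ k → - ⟦ suc k ⟧ℕ) (ℕ.+-suc m n) ⟨
    - ⟦ suc m ℕ.+ suc n ⟧ℕ         ≈⟨ -‿cong (×-homo-+ 1# (suc m) (suc n)) ⟩
    - (⟦ suc m ⟧ℕ + ⟦ suc n ⟧ℕ)    ≈⟨ ⁻¹-∙-comm _ _ ⟨
    - ⟦ suc m ⟧ℕ + - ⟦ suc n ⟧ℕ    ∎

  *-homo : ∀ i j → ⟦ i ℤ.* j ⟧ℤ ≈ ⟦ i ⟧ℤ * ⟦ j ⟧ℤ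
  *-homo (+ m)    (+ n)    = begin
    ⟦ Sign.+ ℤ.◃ m ℕ.* n ⟧ℤ   ≡⟨ ≡.cong ⟦_⟧ℤ (ℤ.+◃n≡+n (m ℕ.* n)) ⟩
    ⟦ m ℕ.* n ⟧ℕ              ≈⟨ ×1-homo-* m n ⟩
    ⟦ m ⟧ℕ * ⟦ n ⟧ℕ           ∎
  *-homo (+ m)    -[1+ n ] = begin
    ⟦ Sign.- ℤ.◃ m ℕ.* suc n ⟧ℤ   ≡⟨ ≡.cong ⟦_⟧ℤ (ℤ.-◃n≡-n (m ℕ.* suc n)) ⟩
    ⟦ ℤ.- (+ (m ℕ.* suc n)) ⟧ℤ    ≈⟨ -‿homo (+ (m ℕ.* suc n)) ⟩
    - ⟦ m ℕ.* suc n ⟧ℕ            ≈⟨ -‿cong (×1-homo-* m (suc n)) ⟩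
    - (⟦ m ⟧ℕ * ⟦ suc n ⟧ℕ)       ≈⟨ -‿distribʳ-* _ _ ⟩
    ⟦ m ⟧ℕ * - ⟦ suc n ⟧ℕ         ∎
  *-homo -[1+ m ] (+ n)    = begin
    ⟦ Sign.- ℤ.◃ suc m ℕ.* n ⟧ℤ   ≡⟨ ≡.cong ⟦_⟧ℤ (ℤ.-◃n≡-n (suc m ℕ.* n)) ⟩
    ⟦ ℤ.- (+ (suc m ℕ.* n)) ⟧ℤ    ≈⟨ -‿homo (+ (suc m ℕ.* n)) ⟩
    - ⟦ suc m ℕ.* n ⟧ℕ            ≈⟨ -‿cong (×1-homo-* (suc m) n) ⟩
    - (⟦ suc m ⟧ℕ * ⟦ n ⟧ℕ)       ≈⟨ -‿distribˡ-* _ _ ⟩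
    - ⟦ suc m ⟧ℕ * ⟦ n ⟧ℕ         ∎
  *-homo -[1+ m ] -[1+ n ] = begin
    ⟦ suc m ℕ.* suc n ⟧ℕ            ≈⟨ ×1-homo-* (suc m) (suc n) ⟩
    ⟦ suc m ⟧ℕ * ⟦ suc n ⟧ℕ         ≈⟨ -‿involutive _ ⟨
    - - (⟦ suc m ⟧ℕ * ⟦ suc n ⟧ℕ)   ≈⟨ -‿cong (-‿distribˡ-* _ _) ⟩
    - (- ⟦ suc m ⟧ℕ * ⟦ suc n ⟧ℕ)   ≈⟨ -‿distribʳ-* _ _ ⟩
    - ⟦ suc m ⟧ℕ * - ⟦ suc n ⟧ℕ     ∎

  morphism : ℤ.+-*-rawRing -Raw-AlmostCommutative⟶ fromCommutativeRing R
  morphism = record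
    { ⟦_⟧ = ⟦_⟧ℤ ; +-homo = +-homo ; *-homo = *-homo ; -‿homo = -‿homo
    ; 0-homo = refl ; 1-homo = refl }

  coefficient≟ : ∀ i j → Maybe (⟦ i ⟧ℤ ≈ ⟦ j ⟧ℤ)
  coefficient≟ i j with i ℤ.≟ j
  ... | yes ≡.refl = just refl
  ... | no  _      = nothing

  open Algebra.Solver.Ring ℤ.+-*-rawRing (fromCommutativeRing R) morphism coefficient≟ public
    using (Polynomial; solve; con; _:=_; _:+_; _:*_; _:-_; :-_; _:^_)

  :0 :1 :2 : ∀ {n} → Polynomial n
  :0 = con (+ 0)
  :1 = con (+ 1)
  :2 = con (+ 2)

-- Inequalities and absolute bounds over an undecidable order

module OrderedField {c ℓ₁ ℓ₂} (ℝ : RealField c ℓ₁ ℓ₂) where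

  open Analysis ℝ
  open IntegerCoefficients commutativeRing
    using (solve; _:=_; _:+_; _:*_; _:-_; :-_; :0; :1; :2)
  open Algebra.Apartness.Properties.HeytingCommutativeRing heytingCommutativeRing
    using (invertibleˡ⇒#)
  open Relation.Binary.Reasoning.Setoid setoid

  -- Inequalities x ≤ y are negations, and so, by tightness, are equations;
  -- excluded middle may therefore be used to prove them.
  by-cases : ∀ {p q} (P : Set p) {Q : Set q} → (P → ¬ Q) → (¬ P → ¬ Q) → ¬ Q
  by-cases P f g q = g (λ p → f p q) q

  ≈-stable : ∀ {x y} → ¬ ¬ (x ≈ y) → x ≈ y
  ≈-stable {x} {y} ¬¬x≈y = proj₁ (tight x y) (λ x#y → ¬¬x≈y (λ x≈y → proj₂ (tight x y) x≈y x#y))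

  x-x≈0 : ∀ x → x - x ≈ 0#
  x-x≈0 = -‿inverseʳ

  <-by : ∀ {x y z} → 0# < z → y - x ≈ z → x < y
  <-by {x} {y} 0<z y-x≈z =
    <-respˡ-≈ (+-identityˡ x)
      (<-respʳ-≈ (solve 2 (λ x y → (y :- x) :+ x := y) refl x y)
        (+-monoˡ-< x (<-respʳ-≈ (sym y-x≈z) 0<z)))

  <⇒0<- : ∀ {x y} → x < y → 0# < y - x
  <⇒0<- {x} x<y = <-respˡ-≈ (x-x≈0 x) (+-monoˡ-< (- x) x<y)

  ≤-by : ∀ {x y z} → 0# ≤ z → y - x ≈ z → x ≤ y
  ≤-by {x} {y} 0≤z y-x≈z y<x =
    0≤z (<-respˡ-≈ y-x≈z (<-respʳ-≈ (x-x≈0 x) (+-monoˡ-< (- x) y<x)))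

  ≤⇒0≤- : ∀ {x y} → x ≤ y → 0# ≤ y - x
  ≤⇒0≤- {x} {y} x≤y y-x<0 = x≤y (<-by (neg⇒-pos y-x<0)
    (solve 2 (λ x y → x :- y := :- (y :- x)) refl x y))

  <⇒≤ : ∀ {x y} → x < y → x ≤ y
  <⇒≤ x<y y<x = <-irrefl refl (<-trans x<y y<x)

  ≈⇒≤ : ∀ {x y} → x ≈ y → x ≤ y
  ≈⇒≤ x≈y y<x = <-irrefl (sym x≈y) y<x

  ≤-refl : ∀ {x} → x ≤ x
  ≤-refl = ≈⇒≤ refl

  ≤-antisym : ∀ {x y} → x ≤ y → y ≤ x → x ≈ y
  ≤-antisym {x} {y} x≤y y≤x = proj₁ (tight x y) λ x#y → case x#y
    where
    case : ¬ (x # y)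
    case x#y with #⇒<⊎> x#y
    ... | inj₁ x<y = y≤x x<y
    ... | inj₂ y<x = x≤y y<x

  ≤-trans : ∀ {x y z} → x ≤ y → y ≤ z → x ≤ z
  ≤-trans x≤y y≤z z<x = y≤z (<-≤-trans z<x x≤y)

  ≤-resp : ∀ {x x′ y y′} → x ≈ x′ → y ≈ y′ → x ≤ y → x′ ≤ y′
  ≤-resp x≈x′ y≈y′ x≤y y′<x′ = x≤y (<-respˡ-≈ (sym y≈y′) (<-respʳ-≈ (sym x≈x′) y′<x′))

  ≤-total : ∀ {q} x y {Q : Set q} → (x ≤ y → ¬ Q) → (y ≤ x → ¬ Q) → ¬ Q
  ≤-total x y f g = by-cases (y < x) (λ y<x → g (<⇒≤ y<x)) f

  -- Most inequalities x ≤ y below are proved by ≤-by from an expression for y - x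
  -- that is nonnegative term by term.
  infixl 6 _⊕_
  infixl 7 _⊗_

  _⊕_ : ∀ {x y} → 0# ≤ x → 0# ≤ y → 0# ≤ x + y
  _⊕_ {x} {y} 0≤x 0≤y x+y<0 = 0≤x (<-by (<-≤-trans (neg⇒-pos x+y<0) (≤-by 0≤y
    (solve 2 (λ x y → (:0 :- x) :- :- (x :+ y) := y) refl x y))) refl)

  -- The axioms multiply only strictly positive elements; a nonnegative factor that is not positive
  -- is 0 by antisymmetry.
  _⊗_ : ∀ {x y} → 0# ≤ x → 0# ≤ y → 0# ≤ x * y
  _⊗_ {x} {y} 0≤x 0≤y =
    by-cases (0# < x) (λ 0<x → by-cases (0# < y)
      (λ 0<y → <⇒≤ (*-pos 0<x 0<y))
      (λ y≤0 → ≈⇒≤ (sym (trans (*-congˡ (≤-antisym y≤0 0≤y)) (zeroʳ x)))))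
    (λ x≤0 → ≈⇒≤ (sym (trans (*-congʳ (≤-antisym x≤0 0≤x)) (zeroˡ y))))

  pos-cancelˡ : ∀ {c x} → 0# < c → 0# ≤ c * x → 0# ≤ x
  pos-cancelˡ {c} {x} 0<c 0≤cx x<0 = 0≤cx (<-by (*-pos 0<c (neg⇒-pos x<0))
    (solve 2 (λ c x → :0 :- c :* x := c :* (:- x)) refl c x))

  0≤1 : 0# ≤ 1#
  0≤1 = <⇒≤ 0<1

  0≤2 : 0# ≤ 1# + 1#
  0≤2 = 0≤1 ⊕ 0≤1

  0<2 : 0# < 1# + 1#
  0<2 = +-pos 0<1 0<1

  fromNat-nonneg : ∀ n → 0# ≤ fromNat n
  fromNat-nonneg 0       = ≤-refl
  fromNat-nonneg (suc n) = 0≤1 ⊕ fromNat-nonneg n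

  *-recip : ∀ x x#0 → x * recip x x#0 ≈ 1#
  *-recip x x#0 = trans (*-congʳ (solve 1 (λ x → x := x :- :0) refl x))
    (proj₂ (proj₂ (#⇒invertible x#0)))

  inverse-unique : ∀ {x y y′} → x * y ≈ 1# → x * y′ ≈ 1# → y ≈ y′
  inverse-unique {x} {y} {y′} xy≈1 xy′≈1 = begin
    y              ≈⟨ *-identityʳ y ⟨
    y * 1#         ≈⟨ *-congˡ xy′≈1 ⟨
    y * (x * y′)   ≈⟨ solve 3 (λ x y z → y :* (x :* z) := x :* y :* z) refl x y y′ ⟩
    x * y * y′     ≈⟨ *-congʳ xy≈1 ⟩
    1# * y′        ≈⟨ *-identityˡ y′ ⟩
    y′             ∎

  recip-cong : ∀ {x y} x#0 y#0 → x ≈ y → recip x x#0 ≈ recip y y#0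
  recip-cong {x} {y} x#0 y#0 x≈y =
    inverse-unique (*-recip x x#0) (trans (*-congʳ x≈y) (*-recip y y#0))

  *-cancelˡ : ∀ {c x y} → c # 0# → c * x ≈ c * y → x ≈ y
  *-cancelˡ {c} {x} {y} c#0 cx≈cy = trans (sym (lemma x)) (trans (*-congˡ cx≈cy) (lemma y))
    where
    lemma : ∀ z → recip c c#0 * (c * z) ≈ z
    lemma z = trans (solve 3 (λ c r z → r :* (c :* z) := c :* r :* z) refl c (recip c c#0) z)
      (trans (*-congʳ (*-recip c c#0)) (*-identityˡ z))

  -- An invertible element is apart from 0 and so has a sign. A negative reciprocal `r` would make
  -- `-1 = x (- r)` positive.
  recip-pos : ∀ {x} (0<x : 0# < x) x#0 → 0# < recip x x#0
  recip-pos {x} 0<x x#0 with #⇒<⊎> (invertibleˡ⇒# {y = 0#} (x , trans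
    (*-congˡ (solve 1 (λ r → r :- :0 := r) refl (recip x x#0))) (*-recip x x#0)))
  ... | inj₂ 0<r = 0<r
  ... | inj₁ r<0 = ⊥-elim (<⇒≤ 0<1 (<-by (*-pos 0<x (neg⇒-pos r<0)) (trans
    (+-congˡ (-‿cong (sym (*-recip x x#0))))
    (solve 2 (λ x r → :0 :- x :* r := x :* (:- r)) refl x (recip x x#0)))))

  -- A common lower bound is enough; no minimum is available constructively.
  with-min : ∀ {q} {Q : Set q} {x y} → 0# < x → 0# < y →
    (∀ z → 0# < z → z ≤ x → z ≤ y → ¬ Q) → ¬ Q
  with-min {x = x} {y} 0<x 0<y k = ≤-total x y (k x 0<x ≤-refl) (λ y≤x → k y 0<y y≤x ≤-refl)

  ≤-limit : ∀ {x y C} → 0# ≤ C → (∀ ε → 0# < ε → x ≤ y + ε * C) → x ≤ y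
  ≤-limit {x} {y} {C} 0≤C x≤y+εC y<x = x≤y+εC ε 0<ε (<-by 0<ε (begin
    x - (y + ε * C)                        ≈⟨ solve 4 (λ x y C e → x :- (y :+ e :* C)
        := (x :- y) :- e :* (:1 :+ C) :+ e)
                                                refl x y C ε ⟩
    (x - y) - ε * D + ε                    ≈⟨ solve 4 (λ d D r e → d :- d :* r :* D :+ e
        := d :* (:1 :- D :* r) :+ e)
                                                refl (x - y) D D⁻¹ ε ⟩
    (x - y) * (1# - D * D⁻¹) + ε           ≈⟨ +-congʳ (*-congˡ
        (trans (+-congˡ (-‿cong (*-recip D _))) (x-x≈0 1#))) ⟩
    (x - y) * 0# + ε                       ≈⟨ trans (+-congʳ (zeroʳ _)) (+-identityˡ ε) ⟩
    ε                                      ∎))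
    where
    D = 1# + C
    0<D : 0# < D
    0<D = <-≤-trans 0<1 (≤-by 0≤C (solve 1 (λ C → :1 :+ C :- :1 := C) refl C))
    D⁻¹ = recip D (pos⇒#0 0<D)
    -- Dividing by `1 + C` keeps the divisor positive when `C` is 0, and makes `x - (y + ε C)` equal
    -- to `ε` itself.
    ε = (x - y) * D⁻¹
    0<ε : 0# < ε
    0<ε = *-pos (<⇒0<- y<x) (recip-pos 0<D _)

  infix 4 ∣_∣≤_
  record ∣_∣≤_ (x e : Carrier) : Set ℓ₂ where
    constructor _,_
    field
      lower : - e ≤ x
      upper : x ≤ e

    0≤e+x : 0# ≤ e + x
    0≤e+x = ≤-resp refl (solve 2 (λ x e → x :- :- e := e :+ x) refl x e) (≤⇒0≤- lower)

    0≤e-x : 0# ≤ e - x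
    0≤e-x = ≤⇒0≤- upper

    0≤e : 0# ≤ e
    0≤e = pos-cancelˡ 0<2 (≤-by (0≤e+x ⊕ 0≤e-x)
      (solve 2 (λ x e → :2 :* e :- :0 := e :+ x :+ (e :- x)) refl x e))

  open ∣_∣≤_ public

  abs-by : ∀ {x e} → 0# ≤ e + x → 0# ≤ e - x → ∣ x ∣≤ e
  abs-by {x} {e} p q = ≤-by p (solve 2 (λ x e → x :- :- e := e :+ x) refl x e) , ≤-by q refl

  abs-resp : ∀ {x x′ e e′} → x ≈ x′ → e ≈ e′ → ∣ x ∣≤ e → ∣ x′ ∣≤ e′
  abs-resp x≈x′ e≈e′ (p , q) = ≤-resp (-‿cong e≈e′) x≈x′ p , ≤-resp x≈x′ e≈e′ q

  abs-weaken : ∀ {x e e′} → e ≤ e′ → ∣ x ∣≤ e → ∣ x ∣≤ e′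
  abs-weaken {x} {e} {e′} e≤e′ p = abs-by
    (≤-by (≤⇒0≤- e≤e′ ⊕ 0≤e+x p) (solve 3 (λ x e e′ → e′ :+ x :- :0 := e′ :- e :+ (e :+ x))
        refl x e e′))
    (≤-by (≤⇒0≤- e≤e′ ⊕ 0≤e-x p) (solve 3 (λ x e e′ → e′ :- x :- :0 := e′ :- e :+ (e :- x))
        refl x e e′))

  abs-0 : ∀ {e} → 0# ≤ e → ∣ 0# ∣≤ e
  abs-0 {e} 0≤e = abs-by (0≤e ⊕ ≤-refl) (≤⇒0≤- 0≤e)

  abs-nonneg : ∀ {x e} → 0# ≤ x → x ≤ e → ∣ x ∣≤ e
  abs-nonneg {x} {e} 0≤x x≤e = abs-by (≤-trans 0≤x x≤e ⊕ 0≤x) (≤⇒0≤- x≤e)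

  abs-neg : ∀ {x e} → ∣ x ∣≤ e → ∣ - x ∣≤ e
  abs-neg {x} {e} p = abs-by (0≤e-x p)
    (≤-resp refl (solve 2 (λ x e → e :+ x := e :- :- x) refl x e) (0≤e+x p))

  abs-+ : ∀ {x y d e} → ∣ x ∣≤ d → ∣ y ∣≤ e → ∣ x + y ∣≤ d + e
  abs-+ {x} {y} {d} {e} p q = abs-by
    (≤-by (0≤e+x p ⊕ 0≤e+x q) (solve 4 (λ x y d e → d :+ e :+ (x :+ y) :- :0 := d :+ x :+ (e :+ y))
        refl x y d e))
    (≤-by (0≤e-x p ⊕ 0≤e-x q) (solve 4 (λ x y d e → d :+ e :- (x :+ y) :- :0 := d :- x :+ (e :- y))
        refl x y d e))

  abs-- : ∀ {x y d e} → ∣ x ∣≤ d → ∣ y ∣≤ e → ∣ x - y ∣≤ d + e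
  abs-- p q = abs-+ p (abs-neg q)

  -- No signs of `x` and `y` are needed: `2 (d e ± x y)` is a sum of products of the nonnegative
  -- numbers `d ± x` and `e ± y`.
  abs-* : ∀ {x y d e} → ∣ x ∣≤ d → ∣ y ∣≤ e → ∣ x * y ∣≤ d * e
  abs-* {x} {y} {d} {e} p q = abs-by
    (pos-cancelˡ 0<2 (≤-by (0≤e-x p ⊗ 0≤e-x q ⊕ 0≤e+x p ⊗ 0≤e+x q)
      (solve 4 (λ x y d e → :2 :* (d :* e :+ x :* y) :- :0
          := (d :- x) :* (e :- y) :+ (d :+ x) :* (e :+ y)) refl x y d e)))
    (pos-cancelˡ 0<2 (≤-by (0≤e-x p ⊗ 0≤e+x q ⊕ 0≤e+x p ⊗ 0≤e-x q)
      (solve 4 (λ x y d e → :2 :* (d :* e :- x :* y) :- :0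
          := (d :- x) :* (e :+ y) :+ (d :+ x) :* (e :- y)) refl x y d e)))

  abs≤0 : ∀ {x} → ∣ x ∣≤ 0# → x ≈ 0#
  abs≤0 {x} p = ≤-antisym (upper p) (≤-by (0≤e+x p)
    (solve 1 (λ x → x :- :0 := :0 :+ x) refl x))

  -- Supplies a bound in closed form for an arbitrary number, wherever some bound for a constant or
  -- an interval is wanted.
  abs-1+x² : ∀ x → ∣ x ∣≤ 1# + x * x
  abs-1+x² x = abs-by
    (pos-cancelˡ 0<2 (≤-by (0≤x² (1# + x) ⊕ 0≤x² x ⊕ 0≤1)
      (solve 1 (λ x → :2 :* (:1 :+ x :* x :+ x) :- :0 := (:1 :+ x) :* (:1 :+ x) :+ x :* x :+ :1)
          refl x)))
    (pos-cancelˡ 0<2 (≤-by (0≤x² (1# - x) ⊕ 0≤x² x ⊕ 0≤1)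
      (solve 1 (λ x → :2 :* (:1 :+ x :* x :- x) :- :0 := (:1 :- x) :* (:1 :- x) :+ x :* x :+ :1)
          refl x)))

-- Riemann integrals: left sums, fundamental theorem, additivity

module Integration {c ℓ₁ ℓ₂} (ℝ : RealField c ℓ₁ ℓ₂) where

  open Analysis ℝ
  open OrderedField ℝ
  open IntegerCoefficients commutativeRing
    using (solve; _:=_; _:+_; _:*_; _:-_; :-_; :0; :1; :2)
  open Relation.Binary.Reasoning.Setoid setoid

  -- A partition given by its successive points, tagged at left endpoints.  Unlike
  -- TaggedPartition it can be concatenated by recursion.
  data Chain : Carrier → Carrier → Set (c ⊔ ℓ₁ ⊔ ℓ₂) where
    end  : ∀ {u v} → u ≈ v → Chain u v
    step : ∀ {u v} w → u ≤ w → Chain w v → Chain u v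

  chain⇒≤ : ∀ {u v} → Chain u v → u ≤ v
  chain⇒≤ (end u≈v)      = ≈⇒≤ u≈v
  chain⇒≤ (step w u≤w C) = ≤-trans u≤w (chain⇒≤ C)

  length : ∀ {u v} → Chain u v → ℕ
  length (end _)      = 0
  length (step _ _ C) = suc (length C)

  vertex : ∀ {u v} (C : Chain u v) → Fin (suc (length C)) → Carrier
  vertex {u} C             Fin.zero    = u
  vertex     (step _ _ C)  (Fin.suc i) = vertex C i

  vertex-last : ∀ {u v} (C : Chain u v) → vertex C (fromℕ (length C)) ≈ v
  vertex-last (end u≈v)    = u≈v
  vertex-last (step _ _ C) = vertex-last C

  vertex-mono : ∀ {u v} (C : Chain u v) i → vertex C (inject₁ i) ≤ vertex C (Fin.suc i)
  vertex-mono (step w u≤w C) Fin.zero    = u≤w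
  vertex-mono (step w u≤w C) (Fin.suc i) = vertex-mono C i

  ≤vertex : ∀ {u v} (C : Chain u v) i → u ≤ vertex C (inject₁ i)
  ≤vertex (step w u≤w C) Fin.zero    = ≤-refl
  ≤vertex (step w u≤w C) (Fin.suc i) = ≤-trans u≤w (≤vertex C i)

  vertex≤ : ∀ {u v} (C : Chain u v) i → vertex C (inject₁ i) ≤ v
  vertex≤ C@(step _ _ _)   Fin.zero    = chain⇒≤ C
  vertex≤ (step w u≤w C)   (Fin.suc i) = vertex≤ C i

  partition : ∀ {u v} → Chain u v → TaggedPartition u v
  partition C = record
    { size      = length C
    ; point     = vertex C
    ; tag       = λ i → vertex C (inject₁ i)
    ; first     = refl
    ; last      = vertex-last C
    ; point≤tag = λ _ → ≤-refl
    ; tag≤point = vertex-mono C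
    ; a≤tag     = ≤vertex C
    ; tag≤b     = vertex≤ C
    }

  leftSum : ∀ {u v} → Chain u v → (∀ t → u ≤ t → t ≤ v → Carrier) → Carrier
  leftSum C = TaggedPartition.riemannSum (partition C)

  Fine : ∀ {u v} → Carrier → Chain u v → Set ℓ₂
  Fine δ C = ∀ i → TaggedPartition.width (partition C) i < δ

  fine-weaken : ∀ {u v δ δ′} {C : Chain u v} → δ ≤ δ′ → Fine δ C → Fine δ′ C
  fine-weaken δ≤δ′ fine i = <-≤-trans (fine i) δ≤δ′

  uniform-shift : ∀ n u h → u + h + fromNat n * h ≈ u + fromNat (suc n) * h
  uniform-shift n u h = solve 3 (λ u h n → u :+ h :+ n :* h := u :+ (:1 :+ n) :* h) refl u h (fromNat n)

  uniform : ∀ n {u v} h → 0# ≤ h → u + fromNat n * h ≈ v → Chain u v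
  uniform 0       {u} h 0≤h eq = end (trans (solve 2 (λ u h → u := u :+ :0 :* h) refl u h) eq)
  uniform (suc n) {u} h 0≤h eq = step (u + h)
    (≤-by 0≤h (solve 2 (λ u h → u :+ h :- u := h) refl u h))
    (uniform n h 0≤h (trans (uniform-shift n u h) eq))

  uniform-fine : ∀ n {u v} h 0≤h (eq : u + fromNat n * h ≈ v) {δ} → h < δ → Fine δ (uniform n h 0≤h eq)
  uniform-fine (suc n) {u} h 0≤h eq h<δ Fin.zero    =
    <-respˡ-≈ (solve 2 (λ u h → h := u :+ h :- u) refl u h) h<δ
  uniform-fine (suc n) {u} h 0≤h eq h<δ (Fin.suc i) = uniform-fine n h 0≤h
      (trans (uniform-shift n u h) eq) h<δ i

  -- Equal steps `(v - u) / N`, where the Archimedean axiom gives `N` above `(v - u) / δ`. That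
  -- quotient is nonnegative, which excludes `N = 0`.
  fine-chain : ∀ {u v δ} → u ≤ v → 0# < δ → ∃[ C ] Fine {u} {v} δ C
  fine-chain {u} {v} {δ} u≤v 0<δ with archimedean ((v - u) * recip δ (pos⇒#0 0<δ))
  ... | 0     , q<0 = ⊥-elim ((≤⇒0≤- u≤v ⊗ <⇒≤ (recip-pos 0<δ _)) q<0)
  ... | suc n , q<N = uniform (suc n) h 0≤h eq , uniform-fine (suc n) h 0≤h eq h<δ
    where
    δ⁻¹ = recip δ (pos⇒#0 0<δ)
    N = fromNat (suc n)
    N⁻¹ = recip N (pos⇒#0 (fromNat-pos (suc n)))
    0<N⁻¹ : 0# < N⁻¹
    0<N⁻¹ = recip-pos (fromNat-pos (suc n)) _
    h = (v - u) * N⁻¹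
    0≤h : 0# ≤ h
    0≤h = ≤⇒0≤- u≤v ⊗ <⇒≤ 0<N⁻¹
    eq : u + N * h ≈ v
    eq = begin
      u + N * ((v - u) * N⁻¹)   ≈⟨ solve 4 (λ u v N M → u :+ N :* ((v :- u) :* M)
          := u :+ (v :- u) :* (N :* M)) refl u v N N⁻¹ ⟩
      u + (v - u) * (N * N⁻¹)   ≈⟨ +-congˡ (*-congˡ (*-recip N _)) ⟩
      u + (v - u) * 1#          ≈⟨ solve 2 (λ u v → u :+ (v :- u) :* :1 := v) refl u v ⟩
      v                         ∎
    h<δ : h < δ
    h<δ = <-by (*-pos (*-pos (<⇒0<- q<N) 0<N⁻¹) 0<δ) (sym (begin
      (N - (v - u) * δ⁻¹) * N⁻¹ * δ
        ≈⟨ solve 5 (λ N d e M δ → (N :- d :* e) :* M :* δ := (N :* M) :* δ :- d :* M :* (δ :* e))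
            refl N (v - u) δ⁻¹ N⁻¹ δ ⟩
      (N * N⁻¹) * δ - h * (δ * δ⁻¹)
        ≈⟨ +-cong (*-congʳ (*-recip N _)) (-‿cong (*-congˡ (*-recip δ _))) ⟩
      1# * δ - h * 1#
        ≈⟨ solve 2 (λ δ h → :1 :* δ :- h :* :1 := δ :- h) refl δ h ⟩
      δ - h ∎))

  infixr 5 _++_

  _++_ : ∀ {u v w} → Chain u v → Chain v w → Chain u w
  -- The endpoints agree only up to `≈`, so a degenerate step of width 0 joins them. Its term in
  -- `leftSum` vanishes, and its fineness is what requires `0# < δ` in `++-fine`.
  end u≈v      ++ D = step _ (≈⇒≤ u≈v) D
  step t u≤t C ++ D = step t u≤t (C ++ D)

  ++-fine : ∀ {u v w δ} (C : Chain u v) {D : Chain v w} → 0# < δ → Fine δ C → Fine δ D → Fine δ (C ++ D)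
  ++-fine (end u≈v)           0<δ fC fD Fin.zero    = <-respˡ-≈
      (trans (sym (x-x≈0 _)) (+-congˡ (-‿cong (sym u≈v)))) 0<δ
  ++-fine (end u≈v)           0<δ fC fD (Fin.suc i) = fD i
  ++-fine (step t u≤t C)      0<δ fC fD Fin.zero    = fC Fin.zero
  ++-fine (step t u≤t C)      0<δ fC fD (Fin.suc i) = ++-fine C 0<δ (λ j → fC (Fin.suc j)) fD i

  leftSum-++ : ∀ {u v w} (C : Chain u v) (D : Chain v w) g →
    leftSum (C ++ D) g ≈ leftSum C (λ t p q → g t p (≤-trans q (chain⇒≤ D))) + leftSum D (λ t p →
        g t (≤-trans (chain⇒≤ C) p))
  leftSum-++ {u} {v} (end u≈v) D g = +-congʳ (trans (*-congˡ
      (trans (+-congˡ (-‿cong u≈v)) (x-x≈0 v))) (zeroʳ _))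
  leftSum-++ (step t u≤t C) D g = trans (+-congˡ (leftSum-++ C D (λ s p → g s (≤-trans u≤t p))))
      (sym (+-assoc _ _ _))

  -- The increments of `F` telescope along the chain. The slack `e` per unit length becomes `K * η`
  -- when the increments carry a quadratic error and the mesh is below `η`.
  leftSum-lower : ∀ {u v δ} (C : Chain u v) g (F : Carrier → Carrier) e → 0# < δ → Fine δ C →
    (∀ s t (u≤s : u ≤ s) (s≤t : s ≤ t) (t≤v : t ≤ v) → t - s < δ →
      F t - F s ≤ (g s u≤s (≤-trans s≤t t≤v) + e) * (t - s)) →
    F v - F u ≤ leftSum C g + e * (v - u)
  leftSum-lower {u} {v} (end u≈v) g F e 0<δ fine incr =
    -- `F` is not known to respect `≈`, so the bound on `F v - F u` comes from `incr` on the
    -- interval from `u` to `v` of width 0.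
    ≤-resp refl (trans (*-congˡ v-u≈0) (trans (zeroʳ _) (sym
        (trans (+-congˡ (*-congˡ v-u≈0)) (trans (+-congˡ (zeroʳ e)) (+-identityˡ 0#))))))
      (incr u v ≤-refl (≈⇒≤ u≈v) ≤-refl (<-respˡ-≈ (sym v-u≈0) 0<δ))
    where
    v-u≈0 : v - u ≈ 0#
    v-u≈0 = trans (+-congˡ (-‿cong u≈v)) (x-x≈0 v)
  leftSum-lower {u} {v} (step w u≤w C) g F e 0<δ fine incr =
    ≤-by (≤⇒0≤- (incr u w ≤-refl u≤w (chain⇒≤ C) (fine Fin.zero))
          ⊕ ≤⇒0≤- (leftSum-lower C (λ t p → g t (≤-trans u≤w p)) F e 0<δ (λ i → fine (Fin.suc i))
                     (λ s t p → incr s t (≤-trans u≤w p))))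
      (solve 9 (λ Fu Fw Fv u w v g e S →
          (g :* (w :- u) :+ S) :+ e :* (v :- u) :- (Fv :- Fu)
          := ((g :+ e) :* (w :- u) :- (Fw :- Fu)) :+ (S :+ e :* (v :- w) :- (Fv :- Fw)))
        refl (F u) (F w) (F v) u w v (g u _ _) e (leftSum C (λ t p → g t (≤-trans u≤w p))))

  sum-neg : ∀ {n} (f h : Fin n → Carrier) → sum (λ i → (- f i) * h i) ≈ - sum (λ i → f i * h i)
  sum-neg {0}     f h = solve 0 (:0 := :- :0) refl
  sum-neg {suc n} f h = trans (+-congˡ (sum-neg (λ i → f (Fin.suc i)) (λ i → h (Fin.suc i))))
    (solve 3 (λ f h s → (:- f) :* h :+ :- s := :- (f :* h :+ s)) refl (f Fin.zero) (h Fin.zero) _)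

  riemann-neg : ∀ {a b g I} → IsRiemannIntegral a b g I →
      IsRiemannIntegral a b (λ t p q → - g t p q) (- I)
  riemann-neg {g = g} {I} R ε 0<ε with R ε 0<ε
  ... | δ , 0<δ , close = δ , 0<δ , λ P fine →
    let open TaggedPartition P
        -ε<S-I , S-I<ε = close P fine
        -S = sum-neg (λ i → g (tag i) (a≤tag i) (tag≤b i)) width
        S = riemannSum g
        -S--I = trans (+-congʳ -S) (solve 2 (λ S I → :- S :- :- I := :- (S :- I)) refl S I)
    in <-respʳ-≈ (sym -S--I) (<-by (<⇒0<- S-I<ε) (solve 2 (λ d e → :- d :- :- e := e :- d)
        refl (S - I) ε))
     , <-respˡ-≈ (sym -S--I) (<-by (<⇒0<- -ε<S-I) (solve 2 (λ d e → e :- :- d := d :- :- e)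
         refl (S - I) ε))

  -- With widths below η, the quadratic errors add up to at most K η (b - a).
  riemann-lower : ∀ {a b g I} → a ≤ b → IsRiemannIntegral a b g I → (F : Carrier → Carrier) →
      ∀ {K} → 0# ≤ K →
    (∀ s t (a≤s : a ≤ s) (s≤t : s ≤ t) (t≤b : t ≤ b) →
      F t - F s ≤ g s a≤s (≤-trans s≤t t≤b) * (t - s) + K * ((t - s) * (t - s))) →
    F b - F a ≤ I
  riemann-lower {a} {b} {g} {I} a≤b R F {K} 0≤K incr = ≤-limit (0≤1 ⊕ 0≤K ⊗ ≤⇒0≤- a≤b) bound
    where
    bound : ∀ ε → 0# < ε → F b - F a ≤ I + ε * (1# + K * (b - a))
    bound ε 0<ε with R ε 0<ε
    ... | δ , 0<δ , close = with-min 0<δ 0<ε λ η 0<η η≤δ η≤ε →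
      let C , fine = fine-chain a≤b 0<η
          S<I+ε = ≤⇒0≤- (<⇒≤ (proj₂ (close (partition C) (fine-weaken {C = C} η≤δ fine))))
          main = leftSum-lower C g F (K * η) 0<η fine (λ s t a≤s s≤t t≤b t-s<η →
            ≤-by (≤⇒0≤- (incr s t a≤s s≤t t≤b) ⊕ 0≤K ⊗ (≤⇒0≤- (<⇒≤ t-s<η) ⊗ ≤⇒0≤- s≤t))
              (solve 5 (λ D g K η h → (g :+ K :* η) :* h :- D
                  := (g :* h :+ K :* (h :* h) :- D) :+ K :* ((η :- h) :* h))
                refl (F t - F s) (g s a≤s _) K η (t - s)))
      in ≤-by (≤⇒0≤- main ⊕ S<I+ε ⊕ 0≤K ⊗ (≤⇒0≤- η≤ε ⊗ ≤⇒0≤- a≤b))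
           (solve 7 (λ D I S K η ε h → I :+ ε :* (:1 :+ K :* h) :- D
              := (S :+ K :* η :* h :- D) :+ (ε :- (S :- I)) :+ K :* ((ε :- η) :* h))
             refl (F b - F a) I (leftSum C g) K η ε (b - a))

  -- The two inequalities are `riemann-lower` for `F` and for `- F`. Integrability is the hypothesis
  -- `R`; the estimate identifies the value.
  fundamental-theorem : ∀ {a b g I} → a ≤ b → IsRiemannIntegral a b g I → (F : Carrier → Carrier) →
      ∀ {K} → 0# ≤ K →
    (∀ s t (a≤s : a ≤ s) (s≤t : s ≤ t) (t≤b : t ≤ b) →
      ∣ F t - F s - g s a≤s (≤-trans s≤t t≤b) * (t - s) ∣≤ K * ((t - s) * (t - s))) →
    I ≈ F b - F a
  fundamental-theorem {a} {b} {g} {I} a≤b R F {K} 0≤K incr = ≤-antisym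
    (≤-by (≤⇒0≤- (riemann-lower {g = λ t p q → - g t p q} a≤b (riemann-neg {g = g} R) (λ t → - F t)
        0≤K (λ s t p q r →
        ≤-by (0≤e+x (incr s t p q r))
          (solve 5 (λ Ft Fs g h e → (:- g) :* h :+ e :- (:- Ft :- :- Fs) := e :+ (Ft :- Fs :- g :* h))
            refl (F t) (F s) (g s p _) (t - s) (K * ((t - s) * (t - s)))))))
      (solve 3 (λ A B I → B :- A :- I := :- I :- (:- B :- :- A)) refl (F a) (F b) I))
    (riemann-lower {g = g} a≤b R F 0≤K (λ s t p q r →
        ≤-by (0≤e-x (incr s t p q r))
          (solve 3 (λ D E e → E :+ e :- D := e :- (D :- E))
              refl (F t - F s) (g s p _ * (t - s)) (K * ((t - s) * (t - s))))))

  leftSum-const-lower : ∀ {u v} (C : Chain u v) g m → (∀ t p q → m ≤ g t p q) →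
      m * (v - u) ≤ leftSum C g
  leftSum-const-lower {u} {v} (end u≈v) g m m≤g =
    ≈⇒≤ (trans (*-congˡ (trans (+-congˡ (-‿cong u≈v)) (x-x≈0 v))) (zeroʳ m))
  leftSum-const-lower {u} {v} (step w u≤w C) g m m≤g = ≤-by
    (≤⇒0≤- (m≤g u ≤-refl _) ⊗ ≤⇒0≤- u≤w ⊕ ≤⇒0≤- (leftSum-const-lower C (λ t p → g t (≤-trans u≤w p))
        m (λ t p → m≤g t _)))
    (solve 6 (λ m u v w g S → g :* (w :- u) :+ S :- m :* (v :- u)
        := (g :- m) :* (w :- u) :+ (S :- m :* (v :- w)))
      refl m u v w (g u _ _) (leftSum C (λ t p → g t (≤-trans u≤w p))))

  -- `J - I` stands for the integral over `[b , d]`, which is not given: integrals are known only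
  -- from a fixed base point. A fine chain through `b` splits the sum for `J`, and its part over
  -- `[b , d]` is at least `m (d - b)`.
  additivity-right : ∀ {a b d g I J} (a≤b : a ≤ b) (b≤d : b ≤ d) →
    IsRiemannIntegral a b (λ t p q → g t p (≤-trans q b≤d)) I → IsRiemannIntegral a d g J →
    ∀ m → (∀ t (p : b ≤ t) q → m ≤ g t (≤-trans a≤b p) q) → m * (d - b) ≤ J - I
  additivity-right {a} {b} {d} {g} {I} {J} a≤b b≤d RI RJ m m≤g = ≤-limit 0≤2 bound
    where
    gI = λ t (p : a ≤ t) (q : t ≤ b) → g t p (≤-trans q b≤d)
    gR = λ t (p : b ≤ t) (q : t ≤ d) → g t (≤-trans a≤b p) q
    bound : ∀ ε → 0# < ε → m * (d - b) ≤ J - I + ε * (1# + 1#)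
    bound ε 0<ε with RI ε 0<ε | RJ ε 0<ε
    ... | δ , 0<δ , closeI | δ′ , 0<δ′ , closeJ = with-min 0<δ 0<δ′ λ η 0<η η≤δ η≤δ′ →
      let C , fineC = fine-chain a≤b 0<η
          D , fineD = fine-chain b≤d 0<η
          SI = ≤⇒0≤- (<⇒≤ (proj₁ (closeI (partition C) (fine-weaken {C = C} η≤δ fineC))))
          SJ = ≤⇒0≤- (<⇒≤ (proj₂ (closeJ (partition (C ++ D))
              (fine-weaken {C = C ++ D} η≤δ′ (++-fine C 0<η fineC fineD)))))
          SD = ≤⇒0≤- (leftSum-const-lower D gR m m≤g)
      in ≤-by (SI ⊕ SJ ⊕ SD)
        (trans
          (solve 7 (λ I J ε M S SC SD → J :- I :+ ε :* :2 :- M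
              := (SC :- I :- :- ε) :+ (ε :- (S :- J)) :+ (SD :- M) :+ (S :- (SC :+ SD)))
            refl I J ε (m * (d - b)) (leftSum (C ++ D) g) (leftSum C gI) (leftSum D gR))
          (trans (+-congˡ (trans (+-congʳ (leftSum-++ C D g)) (x-x≈0 _))) (+-identityʳ _)))

  -- The mirror image, for integrals with a common right endpoint. These define `arctan` at negative
  -- arguments.
  additivity-left : ∀ {a b d g I J} (a≤b : a ≤ b) (b≤d : b ≤ d) →
    IsRiemannIntegral b d (λ t p q → g t (≤-trans a≤b p) q) I → IsRiemannIntegral a d g J →
    ∀ m → (∀ t p (q : t ≤ b) → m ≤ g t p (≤-trans q b≤d)) → m * (b - a) ≤ J - I
  additivity-left {a} {b} {d} {g} {I} {J} a≤b b≤d RI RJ m m≤g = ≤-limit 0≤2 bound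
    where
    gL = λ t (p : a ≤ t) (q : t ≤ b) → g t p (≤-trans q b≤d)
    gI = λ t (p : b ≤ t) (q : t ≤ d) → g t (≤-trans a≤b p) q
    bound : ∀ ε → 0# < ε → m * (b - a) ≤ J - I + ε * (1# + 1#)
    bound ε 0<ε with RI ε 0<ε | RJ ε 0<ε
    ... | δ , 0<δ , closeI | δ′ , 0<δ′ , closeJ = with-min 0<δ 0<δ′ λ η 0<η η≤δ η≤δ′ →
      let C , fineC = fine-chain a≤b 0<η
          D , fineD = fine-chain b≤d 0<η
          SI = ≤⇒0≤- (<⇒≤ (proj₁ (closeI (partition D) (fine-weaken {C = D} η≤δ fineD))))
          SJ = ≤⇒0≤- (<⇒≤ (proj₂ (closeJ (partition (C ++ D))
              (fine-weaken {C = C ++ D} η≤δ′ (++-fine C 0<η fineC fineD)))))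
          SC = ≤⇒0≤- (leftSum-const-lower C gL m m≤g)
      in ≤-by (SI ⊕ SJ ⊕ SC)
        (trans
          (solve 7 (λ I J ε M S SC SD → J :- I :+ ε :* :2 :- M
              := (SD :- I :- :- ε) :+ (ε :- (S :- J)) :+ (SC :- M) :+ (S :- (SC :+ SD)))
            refl I J ε (m * (b - a)) (leftSum (C ++ D) g) (leftSum C gL) (leftSum D gI))
          (trans (+-congˡ (trans (+-congʳ (leftSum-++ C D g)) (x-x≈0 _))) (+-identityʳ _)))

-- Estimates for the logarithm and the arctangent

record ElementaryFunctions {c ℓ₁ ℓ₂} (ℝ : RealField c ℓ₁ ℓ₂) : Set (c ⊔ ℓ₁ ⊔ ℓ₂) where
  open Analysis ℝ
  field
    ln              : ∀ y → 0# < y → Carrier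
    ln-integral     : ∀ y (0<y : 0# < y) → IsLn y 0<y (ln y 0<y)
    arctan          : Carrier → Carrier
    arctan-integral : ∀ x → IsArctan x (arctan x)

module LogArctan {c ℓ₁ ℓ₂} (ℝ : RealField c ℓ₁ ℓ₂) (E : ElementaryFunctions ℝ) where

  open Analysis ℝ
  open ElementaryFunctions E
  open OrderedField ℝ
  open Integration ℝ
  open IntegerCoefficients commutativeRing
    using (solve; _:=_; _:+_; _:*_; _:-_; :-_; :0; :1; :2)
  open Relation.Binary.Reasoning.Setoid setoid

  additivity-right-upper : ∀ {a b d g I J} (a≤b : a ≤ b) (b≤d : b ≤ d) →
    IsRiemannIntegral a b (λ t p q → g t p (≤-trans q b≤d)) I → IsRiemannIntegral a d g J →
    ∀ m → (∀ t (p : b ≤ t) q → g t (≤-trans a≤b p) q ≤ m) → J - I ≤ m * (d - b)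
  additivity-right-upper {b = b} {d} {g} {I} {J} a≤b b≤d RI RJ m g≤m = ≤-by
    (≤⇒0≤- (additivity-right {g = λ t p q → - g t p q} a≤b b≤d
      (riemann-neg {g = λ t p q → g t p (≤-trans q b≤d)} RI) (riemann-neg {g = g} RJ) (- m)
      (λ t p q → ≤-by (≤⇒0≤- (g≤m t p q)) (solve 2 (λ g m → :- g :- :- m := m :- g) refl (g t _ q) m))))
    (solve 4 (λ I J m h → m :* h :- (J :- I) := :- J :- :- I :- (:- m) :* h) refl I J m (d - b))

  additivity-left-upper : ∀ {a b d g I J} (a≤b : a ≤ b) (b≤d : b ≤ d) →
    IsRiemannIntegral b d (λ t p q → g t (≤-trans a≤b p) q) I → IsRiemannIntegral a d g J →
    ∀ m → (∀ t p (q : t ≤ b) → g t p (≤-trans q b≤d) ≤ m) → J - I ≤ m * (b - a)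
  additivity-left-upper {a} {b} {d} {g} {I} {J} a≤b b≤d RI RJ m g≤m = ≤-by
    (≤⇒0≤- (additivity-left {g = λ t p q → - g t p q} a≤b b≤d
      (riemann-neg {g = λ t p q → g t (≤-trans a≤b p) q} RI) (riemann-neg {g = g} RJ) (- m)
      (λ t p q → ≤-by (≤⇒0≤- (g≤m t p q)) (solve 2 (λ g m → :- g :- :- m := m :- g) refl (g t p _) m))))
    (solve 4 (λ I J m h → m :* h :- (J :- I) := :- J :- :- I :- (:- m) :* h) refl I J m (b - a))

  -- Which of `R⁺` and `R⁻` applies cannot be decided, but the equation is stable under double
  -- negation, so a case split on the sign of `x` is allowed. The estimate on `[- M , M]` covers
  -- both cases.
  integral-fundamental : ∀ {x g I M} → ∣ x ∣≤ M → IsIntegral 0# x g I → (F : Carrier → Carrier) →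
      ∀ {K} → 0# ≤ K →
    (∀ s t → - M ≤ s → s ≤ t → t ≤ M → ∣ F t - F s - g s * (t - s) ∣≤ K * ((t - s) * (t - s))) →
    I ≈ F x - F 0#
  integral-fundamental {x} {g} {I} {M} ∣x∣≤M (R⁺ , R⁻) F 0≤K est = ≈-stable (≤-total 0# x
    (λ 0≤x k → k (fundamental-theorem {g = λ t _ _ → g t} 0≤x (R⁺ 0≤x) F 0≤K λ s t 0≤s s≤t t≤x →
      est s t (≤-trans -M≤0 0≤s) s≤t (≤-trans t≤x (upper ∣x∣≤M))))
    (λ x≤0 k → k (begin
      I                ≈⟨ solve 1 (λ I → I := :- :- I) refl I ⟩
      - - I            ≈⟨ -‿cong (fundamental-theorem {g = λ t _ _ → g t} x≤0 (R⁻ x≤0) F 0≤K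
          λ s t x≤s s≤t t≤0 →
                             est s t (≤-trans (lower ∣x∣≤M) x≤s) s≤t (≤-trans t≤0 (0≤e ∣x∣≤M))) ⟩
      - (F 0# - F x)   ≈⟨ solve 2 (λ u v → :- (u :- v) := v :- u) refl (F 0#) (F x) ⟩
      F x - F 0#       ∎)))
    where
    -M≤0 : - M ≤ 0#
    -M≤0 = ≤-by (0≤e ∣x∣≤M) (solve 1 (λ M → :0 :- :- M := M) refl M)

  recip-antitone : ∀ {x y} (0<x : 0# < x) (0<y : 0# < y) x#0 y#0 → x ≤ y → recip y y#0 ≤ recip x x#0
  recip-antitone {x} {y} 0<x 0<y x#0 y#0 x≤y =
    ≤-by (≤⇒0≤- x≤y ⊗ (<⇒≤ (recip-pos 0<x x#0) ⊗ <⇒≤ (recip-pos 0<y y#0))) (sym (begin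
      (y - x) * (p * q)            ≈⟨ solve 4 (λ x y p q → (y :- x) :* (p :* q)
          := y :* q :* p :- x :* p :* q) refl x y p q ⟩
      y * q * p - x * p * q        ≈⟨ +-cong (*-congʳ (*-recip y _)) (-‿cong (*-congʳ (*-recip x _))) ⟩
      1# * p - 1# * q              ≈⟨ solve 2 (λ p q → :1 :* p :- :1 :* q := p :- q) refl p q ⟩
      p - q                        ∎))
    where
    p = recip x x#0
    q = recip y y#0

  -- The tangent of a concave function lies above it: `1 / t` is at most `1 / u` to the right of `u`
  -- and at least `1 / u` to the left. The derivative and growth estimates for `L` all come from
  -- this bound.
  ln-upper : ∀ {u v} 0<u 0<v → 1# ≤ u → 1# ≤ v → ln v 0<v - ln u 0<u ≤ recip u (pos⇒#0 0<u) * (v - u)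
  ln-upper {u} {v} 0<u 0<v 1≤u 1≤v = ≤-total u v
    (λ u≤v → additivity-right-upper {g = λ t 1≤t _ → recip t (pos⇒#0 (<-≤-trans 0<1 1≤t))} 1≤u u≤v
      (proj₁ (ln-integral u 0<u) 1≤u) (proj₁ (ln-integral v 0<v) 1≤v) _
      (λ t u≤t t≤v → recip-antitone 0<u (<-≤-trans 0<u u≤t) _ _ u≤t))
    (λ v≤u → ≤-by (≤⇒0≤- (additivity-right {g = λ t 1≤t _ → recip t (pos⇒#0 (<-≤-trans 0<1 1≤t))}
        1≤v v≤u
      (proj₁ (ln-integral v 0<v) 1≤v) (proj₁ (ln-integral u 0<u) 1≤u) (recip u (pos⇒#0 0<u))
      (λ t v≤t t≤u → recip-antitone (<-≤-trans 0<v v≤t) 0<u _ _ t≤u)))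
      (solve 5 (λ u v r A B → r :* (v :- u) :- (B :- A) := A :- B :- r :* (u :- v)) refl
        u v (recip u (pos⇒#0 0<u)) (ln u 0<u) (ln v 0<v)))

  w κ L : Carrier → Carrier
  w x = 1# + x * x
  κ x = recip (w x) (pos⇒#0 (0<1+x² x))
  L x = ln (w x) (0<1+x² x)

  wκ≈1 : ∀ x → w x * κ x ≈ 1#
  wκ≈1 x = *-recip (w x) _

  0≤κ : ∀ x → 0# ≤ κ x
  0≤κ x = <⇒≤ (recip-pos (0<1+x² x) _)

  1≤w : ∀ x → 1# ≤ w x
  1≤w x = ≤-by (0≤x² x) (solve 1 (λ x → :1 :+ x :* x :- :1 := x :* x) refl x)

  κ≤1 : ∀ x → κ x ≤ 1#
  κ≤1 x = ≤-by (0≤κ x ⊗ 0≤x² x) (trans (+-congʳ (sym (wκ≈1 x)))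
    (solve 2 (λ x k → (:1 :+ x :* x) :* k :- k := k :* (x :* x)) refl x (κ x)))

  κ-bound : ∀ x → ∣ κ x ∣≤ 1#
  κ-bound x = abs-nonneg (0≤κ x) (κ≤1 x)

  L′ : Carrier → Carrier
  L′ x = (x + x) * κ x

  L′-bound : ∀ x → ∣ L′ x ∣≤ 1#
  L′-bound x = abs-by
    (≤-by (0≤κ x ⊗ 0≤x² (1# + x)) (trans (+-congʳ (+-congʳ (sym (wκ≈1 x))))
      (solve 2 (λ x k → (:1 :+ x :* x) :* k :+ (x :+ x) :* k :- :0 := k :* ((:1 :+ x) :* (:1 :+ x)))
          refl x (κ x))))
    (≤-by (0≤κ x ⊗ 0≤x² (1# - x)) (trans (+-congʳ (+-congʳ (sym (wκ≈1 x))))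
      (solve 2 (λ x k → (:1 :+ x :* x) :* k :- (x :+ x) :* k :- :0 := k :* ((:1 :- x) :* (:1 :- x)))
          refl x (κ x))))

  L-upper : ∀ u v → L v - L u ≤ κ u * (w v - w u)
  L-upper u v = ln-upper (0<1+x² u) (0<1+x² v) (1≤w u) (1≤w v)

  κκww≈1 : ∀ u v → κ u * κ v * (w u * w v) ≈ 1#
  κκww≈1 u v = begin
    κ u * κ v * (w u * w v)      ≈⟨ solve 4 (λ p q U V → p :* q :* (U :* V) := (U :* p) :* (V :* q))
        refl (κ u) (κ v) (w u) (w v) ⟩
    (w u * κ u) * (w v * κ v)    ≈⟨ *-cong (wκ≈1 u) (wκ≈1 v) ⟩
    1# * 1#                      ≈⟨ *-identityˡ 1# ⟩
    1#                           ∎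

  κ-diff : ∀ u v → κ v - κ u ≈ κ u * κ v * (w u - w v)
  κ-diff u v = begin
    κ v - κ u                              ≈⟨ solve 2 (λ p q → q :- p := :1 :* q :- :1 :* p)
        refl (κ u) (κ v) ⟩
    1# * κ v - 1# * κ u                    ≈⟨ +-cong (*-congʳ (wκ≈1 u)) (-‿cong (*-congʳ (wκ≈1 v))) ⟨
    w u * κ u * κ v - w v * κ v * κ u      ≈⟨ solve 4 (λ p q U V → U :* p :* q :- V :* q :* p
        := p :* q :* (U :- V)) refl (κ u) (κ v) (w u) (w v) ⟩
    κ u * κ v * (w u - w v)                ∎

  -- Both bounds come from 1 - u / v ≤ ln v - ln u ≤ v / u - 1.
  L-estimate : ∀ u v → ∣ L v - L u - L′ u * (v - u) ∣≤ (1# + 1#) * ((v - u) * (v - u))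
  L-estimate u v = abs-by
    (≤-by (≤⇒0≤- (L-upper v u) ⊕ 0≤x² (v - u) ⊗ (0≤κ u ⊕ 0≤κ u ⊗ 0≤κ v ⊗ 0≤R))
      (begin
        2h² + (L v - L u - L′ u * h) - 0#
          ≈⟨ solve 6 (λ u v A B p q →
               :2 :* ((v :- u) :* (v :- u)) :+ (B :- A :- (u :+ u) :* p :* (v :- u)) :- :0
               := (q :* (W u :- W v) :- (A :- B)) :+ (v :- u) :* ((v :- u) :* (:2 :* :1 :+ p)
                   :+ (q :- p) :* (v :+ u)))
             refl u v (L u) (L v) (κ u) (κ v) ⟩
        upper-gap + h * (h * ((1# + 1#) * 1# + κ u) + (κ v - κ u) * (v + u))
          ≈⟨ +-congˡ (*-congˡ (+-cong (*-congˡ (+-congʳ (*-congˡ (sym (κκww≈1 u v)))))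
              (*-congʳ (κ-diff u v)))) ⟩
        upper-gap + h * (h * ((1# + 1#) * (κ u * κ v * (w u * w v)) + κ u)
            + (κ u * κ v * (w u - w v)) * (v + u))
          ≈⟨ +-congˡ (solve 4 (λ u v p r →
               (v :- u) :* ((v :- u) :* (:2 :* (r :* (W u :* W v)) :+ p)
                   :+ r :* (W u :- W v) :* (v :+ u))
               := (v :- u) :* (v :- u) :* (p :+ r :* (:2 :+ (u :- v) :* (u :- v)
                   :+ (u :* v :* (u :* v) :+ u :* v :* (u :* v)))))
             refl u v (κ u) (κ u * κ v)) ⟩
        upper-gap + h * h * (κ u + κ u * κ v * R) ∎))
    (≤-by (≤⇒0≤- (L-upper u v) ⊕ ≤⇒0≤- (κ≤1 u) ⊗ 0≤x² (v - u) ⊕ 0≤x² (v - u))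
      (solve 5 (λ u v A B p →
          :2 :* ((v :- u) :* (v :- u)) :- (B :- A :- (u :+ u) :* p :* (v :- u)) :- :0
          := p :* (W v :- W u) :- (B :- A) :+ (:1 :- p) :* ((v :- u) :* (v :- u))
              :+ (v :- u) :* (v :- u))
        refl u v (L u) (L v) (κ u)))
    where
    W = λ {n} x → :1 {n} :+ x :* x
    h = v - u
    2h² = (1# + 1#) * (h * h)
    upper-gap = κ v * (w u - w v) - (L u - L v)
    -- This is `2 (w u) (w v) - (u + v)²` as a sum of squares: what the constant 2 leaves after the
    -- difference quotient of `κ`, times `u + v`, is subtracted and `κ u * κ v` factored out.
    R = 1# + 1# + (u - v) * (u - v) + (u * v * (u * v) + u * v * (u * v))
    0≤R : 0# ≤ R
    0≤R = 0≤2 ⊕ 0≤x² (u - v) ⊕ (0≤x² (u * v) ⊕ 0≤x² (u * v))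

  -- `κ v - κ u = κ u κ v (u - v) (u + v)`, and `|u + v| ≤ w u * w v` because twice the gap is a sum
  -- of squares.
  κ-lipschitz : ∀ {u v} → u ≤ v → ∣ κ v - κ u ∣≤ v - u
  κ-lipschitz {u} {v} u≤v = abs-resp (sym (κ-diff u v))
    (trans (*-congˡ (κκww≈1 u v)) (*-identityʳ (v - u)))
    (abs-by
      (≤-by (≤⇒0≤- u≤v ⊗ (0≤κ u ⊗ 0≤κ v ⊗ 0≤half- u v))
        (solve 3 (λ u v r → (v :- u) :* (r :* (W u :* W v)) :+ r :* (W u :- W v) :- :0
          := (v :- u) :* (r :* (W u :* W v :- (u :+ v)))) refl u v (κ u * κ v)))
      (≤-by (≤⇒0≤- u≤v ⊗ (0≤κ u ⊗ 0≤κ v ⊗ 0≤half+ u v))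
        (solve 3 (λ u v r → (v :- u) :* (r :* (W u :* W v)) :- r :* (W u :- W v) :- :0
          := (v :- u) :* (r :* (W u :* W v :+ (u :+ v)))) refl u v (κ u * κ v))))
    where
    W = λ {n} x → :1 {n} :+ x :* x
    0≤half- : ∀ u v → 0# ≤ w u * w v - (u + v)
    0≤half- u v = pos-cancelˡ 0<2 (≤-by
      (0≤x² (1# - u) ⊕ 0≤x² (1# - v) ⊕ 0≤x² u ⊕ 0≤x² v ⊕ 0≤2 ⊗ 0≤x² (u * v))
      (solve 2 (λ u v → :2 :* (W u :* W v :- (u :+ v)) :- :0
         := (:1 :- u) :* (:1 :- u) :+ (:1 :- v) :* (:1 :- v) :+ u :* u :+ v :* v
             :+ :2 :* (u :* v :* (u :* v))) refl u v))
    0≤half+ : ∀ u v → 0# ≤ w u * w v + (u + v)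
    0≤half+ u v = ≤-resp refl
      (solve 2 (λ u v → W (:- u) :* W (:- v) :- (:- u :+ :- v) := W u :* W v :+ (u :+ v))
          refl u v) (0≤half- (- u) (- v))

  κ-near-left : ∀ {u t v} → u ≤ t → t ≤ v → ∣ κ t - κ u ∣≤ v - u
  κ-near-left {u} {t} {v} u≤t t≤v = abs-weaken
    (≤-by (≤⇒0≤- t≤v) (solve 3 (λ u t v → v :- u :- (t :- u) := v :- t) refl u t v)) (κ-lipschitz u≤t)

  -- On `[u , v]` the Lipschitz bound keeps `κ` within `v - u` of `κ u`, so the increment, an
  -- integral over `[u , v]`, deviates from `κ u (v - u)` by at most `(v - u)²`.
  arctan-estimate⁺ : ∀ u v → 0# ≤ u → u ≤ v → ∣ arctan v - arctan u - κ u * (v - u) ∣≤ (v - u) * (v - u)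
  arctan-estimate⁺ u v 0≤u u≤v = abs-by
    (≤-by (≤⇒0≤- (additivity-right {g = λ t _ _ → κ t} 0≤u u≤v R S (κ u - (v - u))
        (λ t u≤t t≤v → ≤-by (0≤e+x (κ-near-left u≤t t≤v)) (solve 3 (λ t u h → t :- (u :- h)
            := h :+ (t :- u)) refl (κ t) (κ u) (v - u)))))
      (solve 4 (λ A B p h → h :* h :+ (B :- A :- p :* h) :- :0 := B :- A :- (p :- h) :* h)
          refl (arctan u) (arctan v) (κ u) (v - u)))
    (≤-by (≤⇒0≤- (additivity-right-upper {g = λ t _ _ → κ t} 0≤u u≤v R S (κ u + (v - u))
        (λ t u≤t t≤v → ≤-by (0≤e-x (κ-near-left u≤t t≤v)) (solve 3 (λ t u h → u :+ h :- t
            := h :- (t :- u)) refl (κ t) (κ u) (v - u)))))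
      (solve 4 (λ A B p h → h :* h :- (B :- A :- p :* h) :- :0 := (p :+ h) :* h :- (B :- A))
          refl (arctan u) (arctan v) (κ u) (v - u)))
    where
    R = proj₁ (arctan-integral u) 0≤u
    S = proj₁ (arctan-integral v) (≤-trans 0≤u u≤v)

  arctan-estimate⁻ : ∀ u v → v ≤ 0# → u ≤ v → ∣ arctan v - arctan u - κ u * (v - u) ∣≤ (v - u) * (v - u)
  arctan-estimate⁻ u v v≤0 u≤v = abs-by
    (≤-by (≤⇒0≤- (additivity-left {g = λ t _ _ → κ t} u≤v v≤0 R S (κ u - (v - u))
        (λ t u≤t t≤v → ≤-by (0≤e+x (κ-near-left u≤t t≤v)) (solve 3 (λ t u h → t :- (u :- h)
            := h :+ (t :- u)) refl (κ t) (κ u) (v - u)))))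
      (solve 4 (λ A B p h → h :* h :+ (B :- A :- p :* h) :- :0 := :- A :- :- B :- (p :- h) :* h)
          refl (arctan u) (arctan v) (κ u) (v - u)))
    (≤-by (≤⇒0≤- (additivity-left-upper {g = λ t _ _ → κ t} u≤v v≤0 R S (κ u + (v - u))
        (λ t u≤t t≤v → ≤-by (0≤e-x (κ-near-left u≤t t≤v)) (solve 3 (λ t u h → u :+ h :- t
            := h :- (t :- u)) refl (κ t) (κ u) (v - u)))))
      (solve 4 (λ A B p h → h :* h :- (B :- A :- p :* h) :- :0 := (p :+ h) :* h :- (:- A :- :- B))
          refl (arctan u) (arctan v) (κ u) (v - u)))
    where
    R = proj₂ (arctan-integral v) v≤0
    S = proj₂ (arctan-integral u) (≤-trans u≤v v≤0)

  -- ∣_∣≤_ is not a negation, so case distinctions are made on its two components.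
  abs-stable : ∀ {p} {P : Set p} {x e} → (P → ∣ x ∣≤ e) → (¬ P → ∣ x ∣≤ e) → ∣ x ∣≤ e
  abs-stable {P = P} f g = by-cases P (λ p → lower (f p)) (λ p → lower (g p)) , by-cases P (λ p →
      upper (f p)) (λ p → upper (g p))

  abs-total : ∀ x y {z e} → (x ≤ y → ∣ z ∣≤ e) → (y ≤ x → ∣ z ∣≤ e) → ∣ z ∣≤ e
  abs-total x y f g = abs-stable {P = y < x} (λ y<x → g (<⇒≤ y<x)) f

  arctan-estimate : ∀ u v → u ≤ v → ∣ arctan v - arctan u - κ u * (v - u) ∣≤ (v - u) * (v - u)
  arctan-estimate u v u≤v = abs-total 0# u (λ 0≤u → arctan-estimate⁺ u v 0≤u u≤v) λ u≤0 →
    abs-total v 0# (λ v≤0 → arctan-estimate⁻ u v v≤0 u≤v) λ 0≤v →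
      -- With 0 between `u` and `v` the path is broken at 0. The errors are `u²` and `v²`, and the
      -- change of slope adds at most `(- u) v`; together they stay below
      -- `(v - u)² = u² + v² - 2 u v`.
      abs-weaken (≤-by (≤⇒0≤- u≤0 ⊗ 0≤v)
        (solve 2 (λ u v → (v :- u) :* (v :- u) :- ((:0 :- u) :* (:0 :- u)
            :+ ((v :- :0) :* (v :- :0) :+ (:0 :- u) :* v)) := (:0 :- u) :* v) refl u v))
        (abs-resp (solve 7 (λ A O B p o u v → (O :- A :- p :* (:0 :- u))
            :+ ((B :- O :- o :* (v :- :0)) :+ (o :- p) :* v) := B :- A :- p :* (v :- u))
            refl (arctan u) (arctan 0#) (arctan v) (κ u) (κ 0#) u v) refl
          (abs-+ (arctan-estimate⁻ u 0# ≤-refl u≤0)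
            (abs-+ (arctan-estimate⁺ 0# v ≤-refl 0≤v) (abs-* (κ-lipschitz u≤0)
                (abs-nonneg 0≤v ≤-refl)))))

  arctan-fundamental : ∀ x (F : Carrier → Carrier) {K} → 0# ≤ K →
    (∀ s t → s ≤ t → ∣ F t - F s - κ s * (t - s) ∣≤ K * ((t - s) * (t - s))) → arctan x ≈ F x - F 0#
  arctan-fundamental x F 0≤K est = integral-fundamental {g = κ} (abs-1+x² x) (arctan-integral x) F 0≤K
    (λ s t _ s≤t _ → est s t s≤t)

  -- `arctan` is itself an antiderivative of `κ`, so the fundamental theorem at 0 equates
  -- `arctan 0#` with `arctan 0# - arctan 0#`.
  arctan-0 : arctan 0# ≈ 0#
  arctan-0 = trans (arctan-fundamental 0# arctan 0≤1
    (λ s t s≤t → abs-resp refl (sym (*-identityˡ _)) (arctan-estimate s t s≤t))) (x-x≈0 _)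

  -- `arctan` is an arbitrary function with the right integrals; that it respects `≈` follows from
  -- its derivative estimate over an interval of width 0.
  arctan-cong : ∀ {x y} → x ≈ y → arctan x ≈ arctan y
  arctan-cong {x} {y} x≈y = sym (begin
    arctan y                                                        ≈⟨ solve 3 (λ A B e → B
        := B :- A :- e :+ (A :+ e)) refl (arctan x) (arctan y) (κ x * (y - x)) ⟩
    arctan y - arctan x - κ x * (y - x) + (arctan x + κ x * (y - x)) ≈⟨ +-cong (abs≤0 (abs-resp
        refl [y-x]²≈0 (arctan-estimate x y (≈⇒≤ x≈y)))) (+-congˡ (trans (*-congˡ y-x≈0) (zeroʳ _))) ⟩
    0# + (arctan x + 0#)                                            ≈⟨ solve 1 (λ A →
        :0 :+ (A :+ :0) := A) refl (arctan x) ⟩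
    arctan x                                                        ∎)
    where
    y-x≈0 : y - x ≈ 0#
    y-x≈0 = trans (+-congˡ (-‿cong x≈y)) (x-x≈0 y)
    [y-x]²≈0 : (y - x) * (y - x) ≈ 0#
    [y-x]²≈0 = trans (*-congˡ y-x≈0) (zeroʳ _)

  κ-even : ∀ x → κ (- x) ≈ κ x
  κ-even x = recip-cong _ _ (solve 1 (λ x → :1 :+ (:- x) :* (:- x) := :1 :+ x :* x) refl x)

  -- t ↦ - arctan (- t) has derivative κ as well.
  arctan-odd : ∀ x → arctan (- x) ≈ - arctan x
  arctan-odd x = sym (begin
    - arctan x                                ≈⟨ -‿cong (arctan-fundamental x (λ t → - arctan (- t))
        0≤2 reflected) ⟩
    - (- arctan (- x) - - arctan (- 0#))      ≈⟨ -‿cong (+-congˡ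
        (-‿cong (-‿cong (trans (arctan-cong (solve 0 (:- :0 := :0) refl)) arctan-0)))) ⟩
    - (- arctan (- x) - - 0#)                 ≈⟨ solve 1 (λ a → :- (:- a :- :- :0) := a)
        refl (arctan (- x)) ⟩
    arctan (- x)                              ∎)
    where
    -- The estimate from `- t` to `- s` has slope `κ t`. Changing it to `κ s` costs another
    -- `(t - s)²` by the Lipschitz bound, hence the factor 2.
    reflected : ∀ s t → s ≤ t → ∣ - arctan (- t) - - arctan (- s) - κ s * (t - s) ∣≤
        (1# + 1#) * ((t - s) * (t - s))
    reflected s t s≤t = abs-resp
      (begin
        arctan (- s) - arctan (- t) - κ (- t) * (- s - - t) + (κ t - κ s) * (t - s)
          ≈⟨ +-congʳ (+-congˡ (-‿cong (*-congʳ (κ-even t)))) ⟩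
        arctan (- s) - arctan (- t) - κ t * (- s - - t) + (κ t - κ s) * (t - s)
          ≈⟨ solve 6 (λ A B p q s t → A :- B :- q :* (:- s :- :- t) :+ (q :- p) :* (t :- s)
              := :- B :- :- A :- p :* (t :- s))
               refl (arctan (- s)) (arctan (- t)) (κ s) (κ t) s t ⟩
        - arctan (- t) - - arctan (- s) - κ s * (t - s) ∎)
      (solve 2 (λ s t → (:- s :- :- t) :* (:- s :- :- t) :+ (t :- s) :* (t :- s)
          := :2 :* ((t :- s) :* (t :- s))) refl s t)
      (abs-+ (arctan-estimate (- t) (- s) (≤-by (≤⇒0≤- s≤t) (solve 2 (λ s t → :- s :- :- t
          := t :- s) refl s t)))
        (abs-* (κ-lipschitz s≤t) (abs-nonneg (≤⇒0≤- s≤t) ≤-refl)))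

  κ-antitone : ∀ {s t} → 0# ≤ s → s ≤ t → κ t ≤ κ s
  κ-antitone {s} {t} 0≤s s≤t = recip-antitone (0<1+x² s) (0<1+x² t) _ _
    (≤-by (≤⇒0≤- s≤t ⊗ (0≤s ⊕ ≤-trans 0≤s s≤t))
      (solve 2 (λ s t → :1 :+ t :* t :- (:1 :+ s :* s) := (t :- s) :* (s :+ t)) refl s t))

  arctan-lower : ∀ {u v} → 0# ≤ u → u ≤ v → κ v * (v - u) ≤ arctan v - arctan u
  arctan-lower {u} {v} 0≤u u≤v = additivity-right {g = λ t _ _ → κ t} 0≤u u≤v
    (proj₁ (arctan-integral u) 0≤u) (proj₁ (arctan-integral v) (≤-trans 0≤u u≤v)) (κ v)
    (λ t u≤t t≤v → κ-antitone (≤-trans 0≤u u≤t) t≤v)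

  arctan-upper : ∀ {u v} → 0# ≤ u → u ≤ v → arctan v - arctan u ≤ κ u * (v - u)
  arctan-upper {u} {v} 0≤u u≤v = additivity-right-upper {g = λ t _ _ → κ t} 0≤u u≤v
    (proj₁ (arctan-integral u) 0≤u) (proj₁ (arctan-integral v) (≤-trans 0≤u u≤v)) (κ u)
    (λ t u≤t t≤v → κ-antitone 0≤u u≤t)

  -- The tangent bounds in both directions squeeze the two values together. Since the hypothesis
  -- concerns `w`, this also gives the evenness of `L`.
  L-cong-w : ∀ {x y} → w x ≈ w y → L x ≈ L y
  L-cong-w {x} {y} wx≈wy = ≤-antisym (lemma (sym wx≈wy)) (lemma wx≈wy)
    where
    lemma : ∀ {u v} → w u ≈ w v → L v ≤ L u
    lemma {u} {v} wu≈wv = ≤-by (≤⇒0≤- (L-upper u v)) (trans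
      (solve 2 (λ A B → A :- B := (:0 :- (B :- A))) refl (L u) (L v))
      (+-congʳ (sym (trans (*-congˡ (trans (+-congˡ (-‿cong wu≈wv)) (x-x≈0 _))) (zeroʳ _)))))

  arctan-1-pos : 0# < arctan 1#
  arctan-1-pos = <-≤-trans (recip-pos (0<1+x² 1#) _) (≤-resp
    (solve 1 (λ k → k :* (:1 :- :0) := k) refl (κ 1#))
    (trans (+-congˡ (-‿cong arctan-0)) (solve 1 (λ a → a :- :0 := a) refl (arctan 1#)))
    (arctan-lower ≤-refl 0≤1))

  pos-cancel-≤ : ∀ {c x y} → 0# < c → c * x ≤ c * y → x ≤ y
  pos-cancel-≤ {c} {x} {y} 0<c cx≤cy = ≤-by (pos-cancelˡ 0<c (≤-by (≤⇒0≤- cx≤cy)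
    (solve 3 (λ c x y → c :* (y :- x) :- :0 := c :* y :- c :* x) refl c x y))) refl

  four : Carrier
  four = 1# + 1# + 1# + 1#

  -- The factor `4² - 1` in `w (4 x) - w x = 15 x²`.
  fifteen : Carrier
  fifteen = four * four - 1#

  0≤15 : 0# ≤ fifteen
  0≤15 = ≤-by (0≤2 ⊗ 0≤2 ⊗ 0≤2 ⊕ 0≤2 ⊗ 0≤2 ⊕ 0≤2 ⊕ 0≤1) (solve 0 (let :4 = :1 :+ :1 :+ :1 :+ :1 in
    :4 :* :4 :- :1 :- :0 := :2 :* :2 :* :2 :+ :2 :* :2 :+ :2 :+ :1) refl)

  x≤4x : ∀ {x} → 0# ≤ x → x ≤ four * x
  x≤4x {x} 0≤x = ≤-by (0≤x ⊕ 0≤x ⊕ 0≤x) (solve 1 (λ x → (:1 :+ :1 :+ :1 :+ :1) :* x :- x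
      := x :+ x :+ x) refl x)

  -- The tangent bound is `3 x κ x`, that is, 3/2 of `L′ x ≤ 1`. The cruder bound `four` avoids a
  -- further constant.
  arctan-quadruple-upper : ∀ {x} → 0# ≤ x → arctan (four * x) - arctan x ≤ four
  arctan-quadruple-upper {x} 0≤x = pos-cancel-≤ 0<2 (≤-by
    (0≤2 ⊗ ≤⇒0≤- (arctan-upper 0≤x (x≤4x 0≤x)) ⊕ (0≤1 ⊕ 0≤2) ⊗ (≤⇒0≤- (upper (L′-bound x)))
        ⊕ (0≤2 ⊕ 0≤2 ⊕ 0≤1))
    (solve 3 (λ x k D → let :4 = :1 :+ :1 :+ :1 :+ :1 in
        :2 :* :4 :- :2 :* D
        := :2 :* (k :* (:4 :* x :- x) :- D) :+ (:1 :+ :2) :* (:1 :- (x :+ x) :* k) :+ (:2 :+ :2 :+ :1))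
      refl x (κ x) (arctan (four * x) - arctan x)))

  w-quadruple : ∀ x → w (four * x) - w x ≈ fifteen * (x * x)
  w-quadruple x = solve 1 (λ x → let :4 = :1 :+ :1 :+ :1 :+ :1 in
    W (:4 :* x) :- W x := (:4 :* :4 :- :1) :* (x :* x)) refl x
    where
    W = λ {n} x → :1 {n} :+ x :* x

  L-quadruple-upper : ∀ x → L (four * x) - L x ≤ fifteen
  L-quadruple-upper x = ≤-trans (L-upper x (four * x)) (≤-by (0≤15 ⊗ 0≤κ x) (begin
    fifteen - κ x * (w (four * x) - w x)         ≈⟨ +-cong
        (sym (trans (*-congˡ (wκ≈1 x)) (*-identityʳ _))) (-‿cong (*-congˡ (w-quadruple x))) ⟩
    fifteen * (w x * κ x) - κ x * (fifteen * (x * x)) ≈⟨ solve 3 (λ x k f →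
        f :* ((:1 :+ x :* x) :* k) :- k :* (f :* (x :* x)) := f :* k) refl x (κ x) fifteen ⟩
    fifteen * κ x                                ∎))

  *-mono-1 : ∀ {x y} → 1# ≤ x → 1# ≤ y → 1# ≤ x * y
  *-mono-1 {x} {y} 1≤x 1≤y = ≤-by (≤⇒0≤- 1≤x ⊗ ≤⇒0≤- 1≤y ⊕ ≤⇒0≤- 1≤x ⊕ ≤⇒0≤- 1≤y)
    (solve 2 (λ x y → x :* y :- :1 := (x :- :1) :* (y :- :1) :+ (x :- :1) :+ (y :- :1)) refl x y)

  -- The tangent at `4 x` gives an increment of at least `15 x² / (1 + 16 x²)`, which is at least
  -- 1/2 because `14 x² ≥ 1`.
  L-quadruple-lower : ∀ {x} → 1# ≤ x → 1# ≤ (1# + 1#) * (L (four * x) - L x)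
  L-quadruple-lower {x} 1≤x = ≤-by
    (0≤2 ⊗ ≤⇒0≤- (L-upper y x) ⊕ 0≤κ y ⊗ (0≤2 ⊗ 0≤7 ⊗ ≤⇒0≤- (*-mono-1 1≤x 1≤x) ⊕ 0≤2 ⊗ 0≤6 ⊕ 0≤1))
    (trans (+-congˡ (-‿cong (sym (wκ≈1 y))))
      (solve 4 (λ x k A B → let y = (:1 :+ :1 :+ :1 :+ :1) :* x in
          :2 :* (B :- A) :- W y :* k
          := :2 :* (k :* (W x :- W y) :- (A :- B)) :+ k :* (:2 :* (:2 :* :2 :+ :2 :+ :1) :* (x :* x
              :- :1) :+ :2 :* (:2 :* :2 :+ :2) :+ :1))
        refl x (κ y) (L x) (L y)))
    where
    W = λ {n} x → :1 {n} :+ x :* x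
    y = four * x
    0≤6 = 0≤2 ⊗ 0≤2 ⊕ 0≤2
    0≤7 = 0≤2 ⊗ 0≤2 ⊕ 0≤2 ⊕ 0≤1

-- Independence of 1, arctan and ln(1 + x²) over the polynomials

module Independence {c ℓ₁ ℓ₂} (ℝ : RealField c ℓ₁ ℓ₂) (E : ElementaryFunctions ℝ) where

  open Analysis ℝ
  open ElementaryFunctions E
  open OrderedField ℝ
  open LogArctan ℝ E
  open IntegerCoefficients commutativeRing
    using (solve; _:=_; _:+_; _:*_; _:-_; :-_; :0; :1; :2)
  open Relation.Binary.Reasoning.Setoid setoid

  -- Leading coefficients may vanish: the index is a strict bound for the degree.
  data PolynomialBelow : ℕ → (Carrier → Carrier) → Set (c ⊔ ℓ₁) where
    vanishing : ∀ {P} → (∀ x → P x ≈ 0#) → PolynomialBelow 0 P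
    leading   : ∀ {d P Q} p → (∀ x → P x ≈ p * x ^ d + Q x) → PolynomialBelow d Q →
        PolynomialBelow (suc d) P

  pow-nonneg : ∀ {x} d → 0# ≤ x → 0# ≤ x ^ d
  pow-nonneg 0       0≤x = 0≤1
  pow-nonneg (suc d) 0≤x = 0≤x ⊗ pow-nonneg d 0≤x

  pow-pos : ∀ {x} d → 0# < x → 0# < x ^ d
  pow-pos 0       0<x = 0<1
  pow-pos (suc d) 0<x = *-pos 0<x (pow-pos d 0<x)

  abs-pow : ∀ {x y} d → ∣ x ∣≤ y → ∣ x ^ d ∣≤ y ^ d
  abs-pow 0       p = abs-nonneg 0≤1 ≤-refl
  abs-pow (suc d) p = abs-* p (abs-pow d p)

  -- The factor `y` on the left replaces an exponent `d - 1` on the right, so `d = 0` needs no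
  -- exception. It becomes the factor `X k` in the asymptotics.
  lower-degree-bound : ∀ {d P} → PolynomialBelow d P →
    ∃[ K ] (0# ≤ K × (∀ {x y} → 1# ≤ y → ∣ x ∣≤ y → ∣ y * P x ∣≤ K * y ^ d))
  lower-degree-bound (vanishing P≈0) = 0# , ≤-refl , λ {x} {y} _ _ →
    abs-resp (sym (trans (*-congˡ (P≈0 x)) (zeroʳ y))) refl (abs-0 (≤-refl ⊗ 0≤1))
  lower-degree-bound (leading {d} {P} {Q} p P≈ Q-poly) with lower-degree-bound Q-poly
  ... | K , 0≤K , bound = 1# + p * p + K , 0≤1 ⊕ 0≤x² p ⊕ 0≤K , λ {x} {y} 1≤y ∣x∣≤y →
    let 0≤y = ≤-trans 0≤1 1≤y in
    abs-weaken (≤-by (0≤K ⊗ (≤⇒0≤- 1≤y ⊗ pow-nonneg d 0≤y))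
        (solve 4 (λ e K y Y → (e :+ K) :* (y :* Y) :- (y :* (e :* Y) :+ K :* Y)
            := K :* ((y :- :1) :* Y)) refl (1# + p * p) K y (y ^ d)))
      (abs-resp (trans (sym (distribˡ y _ _)) (*-congˡ (sym (P≈ x)))) refl
        (abs-+ (abs-* (abs-nonneg 0≤y ≤-refl) (abs-* (abs-1+x² p) (abs-pow d ∣x∣≤y)))
            (bound 1≤y ∣x∣≤y)))

  X : ℕ → Carrier
  X 0       = 1#
  X (suc k) = four * X k

  1≤X : ∀ k → 1# ≤ X k
  1≤X 0       = ≤-refl
  1≤X (suc k) = ≤-trans (1≤X k) (x≤4x (≤-trans 0≤1 (1≤X k)))

  0≤X : ∀ k → 0# ≤ X k
  0≤X k = ≤-trans 0≤1 (1≤X k)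

  N : ℕ → Carrier
  N k = fromNat (suc k)

  -- A quadratic lower bound is what beats the linear growth of the error terms. With ratio 4 it
  -- holds from `k = 0` on; ratio 2 would already fail at `k = 1`.
  N²≤X : ∀ k → N k * N k ≤ X k
  N²≤X 0       = ≈⇒≤ (solve 0 ((:1 :+ :0) :* (:1 :+ :0) := :1) refl)
  N²≤X (suc k) = ≤-by (0≤2 ⊗ 0≤2 ⊗ ≤⇒0≤- (N²≤X k) ⊕ (fromNat-nonneg k
      ⊗ (fromNat-nonneg k ⊕ 0≤2 ⊗ fromNat-nonneg k ⊕ 0≤2 ⊗ 0≤2)))
    (solve 2 (λ n x → (:1 :+ :1 :+ :1 :+ :1) :* x :- (:1 :+ (:1 :+ n)) :* (:1 :+ (:1 :+ n))
      := :2 :* :2 :* (x :- (:1 :+ n) :* (:1 :+ n)) :+ n :* (n :+ :2 :* n :+ :2 :* :2))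
          refl (fromNat k) (X k))

  0≤N : ∀ k → 0# ≤ N k
  0≤N k = fromNat-nonneg (suc k)

  arctan1≤T : ∀ k → arctan 1# ≤ arctan (X k)
  arctan1≤T k = ≤-by (0≤κ (X k) ⊗ ≤⇒0≤- (1≤X k) ⊕ ≤⇒0≤- (arctan-lower 0≤1 (1≤X k)))
    (solve 2 (λ D e → D := e :+ (D :- e)) refl (arctan (X k) - arctan 1#) (κ (X k) * (X k - 1#)))

  -- Linear growth is a crude bound for `arctan`, but as good as boundedness here, since `L (X k)`
  -- grows linearly in `k` anyway.
  T≤N : ∀ k → arctan (X k) ≤ four * N k
  T≤N 0 = ≤-by (≤⇒0≤- (arctan-upper ≤-refl 0≤1) ⊕ ≤⇒0≤- (κ≤1 0#) ⊕ (0≤2 ⊕ 0≤1))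
    (trans (+-congˡ (trans (solve 1 (λ a → :- a := :- (a :- :0))
        refl (arctan 1#)) (-‿cong (+-congˡ (-‿cong (sym arctan-0))))))
      (solve 3 (λ A B k → (:1 :+ :1 :+ :1 :+ :1) :* (:1 :+ :0) :- (A :- B)
          := k :* (:1 :- :0) :- (A :- B) :+ (:1 :- k) :+ (:2 :+ :1))
        refl (arctan 1#) (arctan 0#) (κ 0#)))
  T≤N (suc k) = ≤-by (≤⇒0≤- (T≤N k) ⊕ ≤⇒0≤- (arctan-quadruple-upper (0≤X k)))
    (solve 4 (λ A B f n → f :* (:1 :+ n) :- B := f :* n :- A :+ (f :- (B :- A)))
        refl (arctan (X k)) (arctan (X (suc k))) four (N k))

  T-bound : ∀ k → ∣ arctan (X k) ∣≤ four * N k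
  T-bound k = abs-nonneg (≤-trans (<⇒≤ arctan-1-pos) (arctan1≤T k)) (T≤N k)

  -- 15 for each quadrupling, plus a bound for `|L 1#|`.
  lnConst : Carrier
  lnConst = fifteen + (1# + L 1# * L 1#)

  0≤lnConst : 0# ≤ lnConst
  0≤lnConst = 0≤15 ⊕ (0≤1 ⊕ 0≤x² (L 1#))

  L-bound : ∀ k → ∣ L (X k) ∣≤ lnConst * N k
  L-bound 0 = abs-weaken (≤-by 0≤15 (solve 2 (λ f e → (f :+ e) :* (:1 :+ :0) :- e := f)
      refl fifteen (1# + L 1# * L 1#))) (abs-1+x² (L 1#))
  L-bound (suc k) = abs-weaken
    (≤-by (0≤1 ⊕ 0≤x² (L 1#)) (solve 3 (λ f e n → (f :+ e) :* (:1 :+ n) :- ((f :+ e) :* n :+ f)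
        := e) refl fifteen (1# + L 1# * L 1#) (N k)))
    (abs-resp (solve 2 (λ A B → A :+ (B :- A) := B) refl (L (X k)) (L (X (suc k)))) refl
      (abs-+ (L-bound k) (abs-nonneg 0≤ΔL (L-quadruple-upper (X k)))))
    where
    0≤ΔL : 0# ≤ L (X (suc k)) - L (X k)
    0≤ΔL = pos-cancelˡ 0<2 (≤-trans 0≤1 (L-quadruple-lower (1≤X k)))

  abs-cancelˡ : ∀ {c x e} → 0# < c → ∣ c * x ∣≤ c * e → ∣ x ∣≤ e
  abs-cancelˡ {c} {x} {e} 0<c p = abs-by
    (pos-cancelˡ 0<c (≤-resp refl (sym (distribˡ c e x)) (0≤e+x p)))
    (pos-cancelˡ 0<c (≤-resp refl (solve 3 (λ c x e → c :* e :- c :* x := c :* (e :- x))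
        refl c x e) (0≤e-x p)))

  abs-shrink : ∀ {s t x e} → 0# ≤ s → s ≤ t → 0# < t → ∣ t * x ∣≤ e → ∣ s * x ∣≤ e
  abs-shrink {s} {t} {x} {e} 0≤s s≤t 0<t p = abs-by
    (pos-cancelˡ 0<t (≤-by (≤⇒0≤- s≤t ⊗ 0≤e p ⊕ 0≤s ⊗ 0≤e+x p)
      (solve 4 (λ s t x e → t :* (e :+ s :* x) :- :0 := (t :- s) :* e :+ s :* (e :+ t :* x))
          refl s t x e)))
    (pos-cancelˡ 0<t (≤-by (≤⇒0≤- s≤t ⊗ 0≤e p ⊕ 0≤s ⊗ 0≤e-x p)
      (solve 4 (λ s t x e → t :* (e :- s :* x) :- :0 := (t :- s) :* e :+ s :* (e :- t :* x))
          refl s t x e)))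

  multiples-bounded : ∀ {y K} → (∀ k → N k * y ≤ K) → y ≤ 0#
  multiples-bounded {y} {K} Ny≤K 0<y with archimedean (K * recip y (pos⇒#0 0<y))
  ... | n , q<n = Ny≤K n (<-by (+-pos (*-pos (<⇒0<- q<n) 0<y) 0<y)
    (trans (+-congˡ (-‿cong (sym (trans (*-congˡ (*-recip y _)) (*-identityʳ K)))))
      (solve 4 (λ n y K r → (:1 :+ n) :* y :- K :* (y :* r) := (n :- K :* r) :* y :+ y)
          refl (fromNat n) y K (recip y (pos⇒#0 0<y)))))

  -- `N k * N k ≤ X k` lets one factor `N k` cancel, so all multiples `N k * y` lie within `K`,
  -- which the Archimedean axiom permits only for `y ≈ 0#`.
  linear-growth⇒0 : ∀ {y K} → (∀ k → ∣ X k * y ∣≤ K * N k) → y ≈ 0#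
  linear-growth⇒0 {y} {K} bound = ≤-antisym (multiples-bounded (λ k → upper (Ny k)))
    (≤-by (≤⇒0≤- (multiples-bounded (λ k → upper (abs-resp (solve 2 (λ n y → :- (n :* y)
        := n :* (:- y)) refl (N k) y) refl (abs-neg (Ny k))))))
      (solve 1 (λ y → y :- :0 := :0 :- :- y) refl y))
    where
    Ny : ∀ k → ∣ N k * y ∣≤ K
    Ny k = abs-cancelˡ (fromNat-pos (suc k)) (abs-resp (*-assoc (N k) (N k) y) (*-comm K (N k))
      (abs-shrink (0≤N k ⊗ 0≤N k) (N²≤X k) (<-≤-trans 0<1 (1≤X k)) (bound k)))

  abs-pow-1 : ∀ {σ} d → ∣ σ ∣≤ 1# → ∣ σ ^ d ∣≤ 1#
  abs-pow-1 0       p = abs-nonneg 0≤1 ≤-refl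
  abs-pow-1 (suc d) p = abs-resp refl (*-identityˡ 1#) (abs-* p (abs-pow-1 d p))

  sign-pow : ∀ {σ} x d → σ * σ ≈ 1# → σ ^ d * (σ * x) ^ d ≈ x ^ d
  sign-pow     x 0       σσ≈1 = *-identityˡ 1#
  sign-pow {σ} x (suc d) σσ≈1 = begin
    σ * σ ^ d * (σ * x * (σ * x) ^ d)     ≈⟨ solve 4 (λ σ x s t → σ :* s :* (σ :* x :* t)
        := σ :* σ :* (x :* (s :* t))) refl σ x (σ ^ d) ((σ * x) ^ d) ⟩
    σ * σ * (x * (σ ^ d * (σ * x) ^ d))   ≈⟨ *-cong σσ≈1 (*-congˡ (sign-pow x d σσ≈1)) ⟩
    1# * (x * x ^ d)                      ≈⟨ *-identityˡ _ ⟩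
    x * x ^ d                             ∎

  module LeadingCoefficients {d P Q R} (p q r : Carrier)
    (P-poly : PolynomialBelow d P) (Q-poly : PolynomialBelow d Q) (R-poly : PolynomialBelow d R)
    (relation : ∀ x → (p * x ^ d + P x) + (q * x ^ d + Q x) * arctan x + (r * x ^ d + R x) * L x ≈ 0#) where

    KP = proj₁ (lower-degree-bound P-poly)
    KQ = proj₁ (lower-degree-bound Q-poly)
    KR = proj₁ (lower-degree-bound R-poly)

    K : Carrier
    K = KP + KQ * four + KR * lnConst

    0≤K : 0# ≤ K
    0≤K = proj₁ (proj₂ (lower-degree-bound P-poly))
        ⊕ proj₁ (proj₂ (lower-degree-bound Q-poly)) ⊗ (0≤2 ⊕ 0≤1 ⊕ 0≤1)
        ⊕ proj₁ (proj₂ (lower-degree-bound R-poly)) ⊗ 0≤lnConst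

    -- σ = ± 1; only σ² = 1 and the parities of arctan and ln(1 + x²) matter.
    asymptotics : ∀ σ k → ∣ σ ∣≤ 1# → σ * σ ≈ 1# → arctan (σ * X k) ≈ σ * arctan (X k) →
        L (σ * X k) ≈ L (X k) →
      ∣ X k * (p + q * (σ * arctan (X k)) + r * L (X k)) ∣≤ K * N k
    asymptotics σ k ∣σ∣≤1 σσ≈1 T-sign L-sign = abs-cancelˡ (pow-pos d (<-≤-trans 0<1 (1≤X k)))
      (abs-resp leading≈ refl (abs-neg (abs-weaken
        (≤-by (proj₁ (proj₂ (lower-degree-bound P-poly)) ⊗ Y≥0 ⊗ fromNat-nonneg k)
          (solve 7 (λ a b c f l Y n → Y :* ((a :+ b :* f :+ c :* l) :* (:1 :+ n))
              :- :1 :* (a :* Y :+ b :* Y :* (f :* (:1 :+ n)) :+ c :* Y :* (l :* (:1 :+ n)))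
             := a :* Y :* n) refl KP KQ KR four lnConst Y (fromNat k)))
        (abs-* (abs-pow-1 d ∣σ∣≤1)
          (abs-+ (abs-+ (bound P-poly) (abs-* (bound Q-poly) T-bounded))
              (abs-* (bound R-poly) (L-bound k)))))))
      where
      x = σ * X k
      Y = X k ^ d
      T = σ * arctan (X k)
      l = L (X k)
      Y≥0 : 0# ≤ Y
      Y≥0 = pow-nonneg d (0≤X k)
      T-bounded : ∣ T ∣≤ four * N k
      T-bounded = abs-resp refl (*-identityˡ _) (abs-* ∣σ∣≤1 (T-bound k))
      ∣x∣≤X : ∣ x ∣≤ X k
      ∣x∣≤X = abs-resp refl (*-identityˡ _) (abs-* ∣σ∣≤1 (abs-nonneg (0≤X k) ≤-refl))
      bound : ∀ {G} (G-poly : PolynomialBelow d G) → ∣ X k * G x ∣≤ proj₁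
          (lower-degree-bound G-poly) * Y
      bound G-poly = proj₂ (proj₂ (lower-degree-bound G-poly)) (1≤X k) ∣x∣≤X
      relation′ : (p * x ^ d + P x) + (q * x ^ d + Q x) * T + (r * x ^ d + R x) * l ≈ 0#
      relation′ = trans (+-cong (+-congˡ (*-congˡ (sym T-sign))) (*-congˡ (sym L-sign))) (relation x)
      -- The relation trades the leading terms for minus the lower ones, which `bound` controls.
      -- Multiplying by `σ ^ d` turns `(σ X k) ^ d` into `Y`.
      leading≈ : - (σ ^ d * (X k * P x + X k * Q x * T + X k * R x * l))
          ≈ Y * (X k * (p + q * T + r * l))
      leading≈ = begin
        - (s * (y * P x + y * Q x * T + y * R x * l))
          ≈⟨ solve 7 (λ s y a b c T l → :- (s :* (y :* a :+ y :* b :* T :+ y :* c :* l))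
              := :- (s :* y :* (a :+ b :* T :+ c :* l))) refl s y (P x) (Q x) (R x) T l ⟩
        - (s * y * (P x + Q x * T + R x * l))
          ≈⟨ solve 4 (λ s y A B → :- (s :* y :* A) := s :* y :* B :- s :* y :* (B :+ A))
              refl s y (P x + Q x * T + R x * l) (z * V) ⟩
        s * y * (z * V) - s * y * (z * V + (P x + Q x * T + R x * l))
          ≈⟨ +-congˡ (-‿cong (trans (*-congˡ (trans
               (solve 9 (λ z p q r T l a b c → z :* (p :+ q :* T :+ r :* l)
                   :+ (a :+ b :* T :+ c :* l) := p :* z :+ a :+ (q :* z :+ b) :* T
                   :+ (r :* z :+ c) :* l)
                 refl z p q r T l (P x) (Q x) (R x)) relation′)) (zeroʳ _))) ⟩
        s * y * (z * V) - 0#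
          ≈⟨ solve 4 (λ s y z V → s :* y :* (z :* V) :- :0 := (s :* z) :* (y :* V)) refl s y z V ⟩
        s * z * (y * V)
          ≈⟨ *-congʳ (sign-pow (X k) d σσ≈1) ⟩
        Y * (y * V) ∎
        where
        s = σ ^ d
        y = X k
        z = x ^ d
        V = p + q * T + r * l

    asymptotics⁺ : ∀ k → ∣ X k * (p + q * (1# * arctan (X k)) + r * L (X k)) ∣≤ K * N k
    asymptotics⁺ k = asymptotics 1# k (abs-nonneg 0≤1 ≤-refl) (*-identityˡ 1#)
      (trans (arctan-cong (*-identityˡ _)) (sym (*-identityˡ _)))
          (L-cong-w (+-congˡ (*-cong (*-identityˡ _) (*-identityˡ _))))

    asymptotics⁻ : ∀ k → ∣ X k * (p + q * ((- 1#) * arctan (X k)) + r * L (X k)) ∣≤ K * N k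
    asymptotics⁻ k = asymptotics (- 1#) k (abs-neg (abs-nonneg 0≤1 ≤-refl))
        (solve 0 ((:- :1) :* (:- :1) := :1) refl)
      (trans (arctan-cong (solve 1 (λ x → (:- :1) :* x := :- x)
          refl _)) (trans (arctan-odd (X k)) (solve 1 (λ x → :- x := (:- :1) :* x) refl _)))
      (L-cong-w (solve 1 (λ x → :1 :+ (:- :1) :* x :* ((:- :1) :* x) := :1 :+ x :* x) refl (X k)))

    even-part : ∀ k → ∣ X k * (p + r * L (X k)) ∣≤ K * N k
    even-part k = abs-cancelˡ 0<2 (abs-resp
      (solve 6 (λ x p q r t l → x :* (p :+ q :* (:1 :* t) :+ r :* l)
          :+ x :* (p :+ q :* ((:- :1) :* t) :+ r :* l) := :2 :* (x :* (p :+ r :* l)))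
        refl (X k) p q r (arctan (X k)) (L (X k)))
      (solve 1 (λ b → b :+ b := :2 :* b) refl (K * N k)) (abs-+ (asymptotics⁺ k) (asymptotics⁻ k)))

    odd-part : ∀ k → ∣ arctan (X k) * (X k * q) ∣≤ K * N k
    odd-part k = abs-cancelˡ 0<2 (abs-resp
      (solve 6 (λ x p q r t l → x :* (p :+ q :* (:1 :* t) :+ r :* l)
          :- x :* (p :+ q :* ((:- :1) :* t) :+ r :* l) := :2 :* (t :* (x :* q)))
        refl (X k) p q r (arctan (X k)) (L (X k)))
      (solve 1 (λ b → b :+ b := :2 :* b) refl (K * N k)) (abs-- (asymptotics⁺ k) (asymptotics⁻ k)))

    q≈0 : q ≈ 0#
    q≈0 = *-cancelˡ (pos⇒#0 arctan-1-pos) (trans (linear-growth⇒0 (λ k →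
      abs-resp (solve 3 (λ t x q → t :* (x :* q) := x :* (t :* q)) refl (arctan 1#) (X k) q) refl
        (abs-shrink (<⇒≤ arctan-1-pos) (arctan1≤T k) (<-≤-trans arctan-1-pos (arctan1≤T k)) (odd-part k))))
            (sym (zeroʳ _)))

    -- As `X (suc k) = 4 X k`, subtracting four times the even part at `k` from the one at `suc k`
    -- cancels `p`. The bounds add up to `K (k + 2) + 4 K (k + 1) ≤ 6 K (k + 1)`, and halving leaves
    -- `3 K`.
    r≈0 : r ≈ 0#
    r≈0 = linear-growth⇒0 (λ k → abs-resp (*-identityˡ _) (sym (*-assoc _ K (N k)))
      (abs-shrink 0≤1 (L-quadruple-lower (1≤X k)) (<-≤-trans 0<1 (L-quadruple-lower (1≤X k)))
          (abs-cancelˡ 0<2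
        (abs-weaken (≤-by (0≤K ⊗ fromNat-nonneg k)
            (solve 2 (λ K n → :2 :* ((:1 :+ :2) :* (K :* (:1 :+ n)))
                :- (K :* (:1 :+ (:1 :+ n)) :+ (:1 :+ :1 :+ :1 :+ :1) :* (K :* (:1 :+ n))) := K :* n)
                refl K (fromNat k)))
          (abs-resp (solve 5 (λ x p r l m → (:1 :+ :1 :+ :1 :+ :1) :* x :* (p :+ r :* m)
              :- (:1 :+ :1 :+ :1 :+ :1) :* (x :* (p :+ r :* l)) := :2 :* (:2 :* (m :- l) :* (x :* r)))
              refl (X k) p r (L (X k)) (L (X (suc k)))) refl
            (abs-- (even-part (suc k)) (abs-* (abs-nonneg (0≤2 ⊕ 0≤1 ⊕ 0≤1) ≤-refl) (even-part k))))))))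

    p≈0 : p ≈ 0#
    p≈0 = linear-growth⇒0 (λ k → abs-resp (*-congˡ (trans (+-congˡ (trans (*-congʳ r≈0) (zeroˡ _)))
        (+-identityʳ p))) refl (even-part k))

  -- Once the three leading coefficients vanish, the relation passes to the tails, whose common
  -- degree bound is smaller by one.
  independence : ∀ d {P Q R} → PolynomialBelow d P → PolynomialBelow d Q → PolynomialBelow d R →
    (∀ x → P x + Q x * arctan x + R x * L x ≈ 0#) → (∀ x → P x ≈ 0#) × (∀ x → Q x ≈ 0#)
  independence 0 (vanishing P≈0) (vanishing Q≈0) _ _ = P≈0 , Q≈0
  independence (suc d) (leading p P≈ P-poly) (leading q Q≈ Q-poly) (leading r R≈ R-poly) relation =
    (λ x → trans (drop (P≈ x) p≈0) (proj₁ vanish x)) , (λ x → trans (drop (Q≈ x) q≈0) (proj₂ vanish x))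
    where
    open LeadingCoefficients p q r P-poly Q-poly R-poly
      (λ x → trans (+-cong (+-cong (sym (P≈ x)) (*-congʳ (sym (Q≈ x)))) (*-congʳ (sym (R≈ x))))
          (relation x))
    drop : ∀ {u v p y} → u ≈ p * y + v → p ≈ 0# → u ≈ v
    drop u≈py+v p≈0 = trans u≈py+v (trans (+-congʳ (trans (*-congʳ p≈0) (zeroˡ _))) (+-identityˡ _))
    vanish = independence d P-poly Q-poly R-poly
      (λ x → trans (+-cong (+-cong (sym (drop (P≈ x) p≈0)) (*-congʳ (sym (drop (Q≈ x) q≈0))))
          (*-congʳ (sym (drop (R≈ x) r≈0)))) (relation x))

-- Differentiation with quadratic remainder; the iterated integrals

module Antiderivatives {c ℓ₁ ℓ₂} (ℝ : RealField c ℓ₁ ℓ₂) (E : ElementaryFunctions ℝ) where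

  open Analysis ℝ
  open ElementaryFunctions E
  open OrderedField ℝ
  open Integration ℝ using (fundamental-theorem)
  open LogArctan ℝ E
  open IntegerCoefficients commutativeRing
    using (solve; _:=_; _:+_; _:*_; _:-_; :-_; :0; :1; :2)
  open Algebra.Properties.Semiring.Mult (CommutativeRing.semiring commutativeRing) using
      (×-homo-+; ×1-homo-*)
  open Relation.Binary.Reasoning.Setoid setoid

  module Differentiation (M : Carrier) (0≤M : 0# ≤ M) where

    -- G is the derivative of F on [- M , M] with quadratic remainder.  Requiring
    -- s ≤ t avoids absolute values of t - s and suffices for left Riemann sums.
    record Derivative (F G : Carrier → Carrier) : Set (c ⊔ ℓ₂) where
      field
        maxF maxG K : Carrier
        0≤K         : 0# ≤ K
        boundF      : ∀ t → ∣ t ∣≤ M → ∣ F t ∣≤ maxF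
        boundG      : ∀ t → ∣ t ∣≤ M → ∣ G t ∣≤ maxG
        estimate    : ∀ s t → - M ≤ s → s ≤ t → t ≤ M →
                      ∣ F t - F s - G s * (t - s) ∣≤ K * ((t - s) * (t - s))

    open Derivative

    ∣0∣≤M : ∣ 0# ∣≤ M
    ∣0∣≤M = abs-0 0≤M

    0≤maxF : ∀ {F G} (D : Derivative F G) → 0# ≤ maxF D
    0≤maxF D = 0≤e (boundF D 0# ∣0∣≤M)

    0≤maxG : ∀ {F G} (D : Derivative F G) → 0# ≤ maxG D
    0≤maxG D = 0≤e (boundG D 0# ∣0∣≤M)

    derivative-resp : ∀ {F F′ G G′} → (∀ x → F x ≈ F′ x) → (∀ x → G x ≈ G′ x) → Derivative F G →
        Derivative F′ G′
    derivative-resp F≈ G≈ D = record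
      { maxF = maxF D ; maxG = maxG D ; K = K D ; 0≤K = 0≤K D
      ; boundF = λ t t∈ → abs-resp (F≈ t) refl (boundF D t t∈)
      ; boundG = λ t t∈ → abs-resp (G≈ t) refl (boundG D t t∈)
      ; estimate = λ s t p q r → abs-resp (+-cong (+-cong (F≈ t) (-‿cong (F≈ s)))
          (-‿cong (*-congʳ (G≈ s)))) refl (estimate D s t p q r)
      }

    derivative-const : ∀ k → Derivative (λ _ → k) (λ _ → 0#)
    derivative-const k = record
      { maxF = 1# + k * k ; maxG = 0# ; K = 0# ; 0≤K = ≤-refl
      ; boundF = λ _ _ → abs-1+x² k
      ; boundG = λ _ _ → abs-0 ≤-refl
      ; estimate = λ s t _ _ _ → abs-resp (solve 3 (λ k s t → :0 := k :- k :- :0 :* (t :- s))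
          refl k s t) (sym (zeroˡ _)) (abs-0 ≤-refl)
      }

    derivative-id : Derivative (λ x → x) (λ _ → 1#)
    derivative-id = record
      { maxF = M ; maxG = 1# ; K = 0# ; 0≤K = ≤-refl
      ; boundF = λ _ t∈ → t∈
      ; boundG = λ _ _ → abs-nonneg 0≤1 ≤-refl
      ; estimate = λ s t _ _ _ → abs-resp (solve 2 (λ s t → :0 := t :- s :- :1 :* (t :- s))
          refl s t) (sym (zeroˡ _)) (abs-0 ≤-refl)
      }

    derivative-+ : ∀ {F G F′ G′} → Derivative F G → Derivative F′ G′ →
        Derivative (λ x → F x + F′ x) (λ x → G x + G′ x)
    derivative-+ {F} {G} {F′} {G′} D E = record
      { maxF = maxF D + maxF E ; maxG = maxG D + maxG E ; K = K D + K E ; 0≤K = 0≤K D ⊕ 0≤K E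
      ; boundF = λ t t∈ → abs-+ (boundF D t t∈) (boundF E t t∈)
      ; boundG = λ t t∈ → abs-+ (boundG D t t∈) (boundG E t t∈)
      ; estimate = λ s t p q r → abs-resp
          (solve 7 (λ a b g a′ b′ g′ h → (a :- b :- g :* h) :+ (a′ :- b′ :- g′ :* h)
              := a :+ a′ :- (b :+ b′) :- (g :+ g′) :* h)
            refl (F t) (F s) (G s) (F′ t) (F′ s) (G′ s) (t - s))
          (sym (distribʳ _ (K D) (K E))) (abs-+ (estimate D s t p q r) (estimate E s t p q r))
      }

    width≤2M : ∀ {s t} → - M ≤ s → t ≤ M → t - s ≤ M + M
    width≤2M {s} {t} -M≤s t≤M = ≤-by (≤⇒0≤- -M≤s ⊕ ≤⇒0≤- t≤M)
      (solve 3 (λ s t M → M :+ M :- (t :- s) := (s :- :- M) :+ (M :- t)) refl s t M)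

    inside-left : ∀ {s t} → - M ≤ s → s ≤ t → t ≤ M → ∣ s ∣≤ M
    inside-left -M≤s s≤t t≤M = -M≤s , ≤-trans s≤t t≤M

    inside-right : ∀ {s t} → - M ≤ s → s ≤ t → t ≤ M → ∣ t ∣≤ M
    inside-right -M≤s s≤t t≤M = ≤-trans -M≤s s≤t , t≤M

    -- The remainder is (remainder of `F`) `F′ t` + `F s` (remainder of `F′`) +
    -- `G s h (F′ t - F′ s)` with `h = t - s`. Expanding the last increment leaves a term in `h³`,
    -- which `h ≤ 2 M` makes quadratic. This is why the bounds on functions and derivatives are
    -- carried along.
    derivative-* : ∀ {F G F′ G′} → Derivative F G → Derivative F′ G′ →
      Derivative (λ x → F x * F′ x) (λ x → G x * F′ x + F x * G′ x)
    derivative-* {F} {G} {F′} {G′} D E = record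
      { maxF = maxF D * maxF E
      ; maxG = maxG D * maxF E + maxF D * maxG E
      ; K = K D * maxF E + maxF D * K E + maxG D * (maxG E + K E * (M + M))
      ; 0≤K = 0≤K D ⊗ 0≤maxF E ⊕ 0≤maxF D ⊗ 0≤K E ⊕ 0≤maxG D ⊗ (0≤maxG E ⊕ 0≤K E ⊗ (0≤M ⊕ 0≤M))
      ; boundF = λ t t∈ → abs-* (boundF D t t∈) (boundF E t t∈)
      ; boundG = λ t t∈ → abs-+ (abs-* (boundG D t t∈) (boundF E t t∈))
          (abs-* (boundF D t t∈) (boundG E t t∈))
      ; estimate = λ s t p q r →
          let s∈ = inside-left p q r
              h≥0 = ≤⇒0≤- q
              ∣h∣ = abs-nonneg h≥0 ≤-refl
          in abs-weaken
            (≤-by (0≤maxG D ⊗ (0≤K E ⊗ (h≥0 ⊗ h≥0 ⊗ ≤⇒0≤- (width≤2M p r))))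
              (solve 8 (λ k b b′ k′ g g′ m h →
                 (k :* b′ :+ b :* k′ :+ g :* (g′ :+ k′ :* (m :+ m))) :* (h :* h)
                   :- (k :* (h :* h) :* b′ :+ b :* (k′ :* (h :* h))
                       :+ g :* h :* (g′ :* h :+ k′ :* (h :* h)))
                 := g :* (k′ :* (h :* h :* (m :+ m :- h))))
                refl (K D) (maxF D) (maxF E) (K E) (maxG D) (maxG E) M (t - s)))
            (abs-resp
              (solve 7 (λ a b g a′ b′ g′ h →
                 (a :- b :- g :* h) :* a′ :+ b :* (a′ :- b′ :- g′ :* h)
                     :+ g :* h :* (g′ :* h :+ (a′ :- b′ :- g′ :* h))
                 := a :* a′ :- b :* b′ :- (g :* b′ :+ b :* g′) :* h)
                refl (F t) (F s) (G s) (F′ t) (F′ s) (G′ s) (t - s)) refl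
              (abs-+ (abs-+ (abs-* (estimate D s t p q r) (boundF E t (inside-right p q r)))
                            (abs-* (boundF D s s∈) (estimate E s t p q r)))
                     (abs-* (abs-* (boundG D s s∈) ∣h∣)
                            (abs-+ (abs-* (boundG E s s∈) ∣h∣) (estimate E s t p q r)))))
      }

    derivative-scale : ∀ k {F G} → Derivative F G → Derivative (λ x → k * F x) (λ x → k * G x)
    derivative-scale k {F} D = derivative-resp (λ _ → refl) (λ x →
        trans (+-congʳ (zeroˡ (F x))) (+-identityˡ _))
      (derivative-* (derivative-const k) D)

    -- The estimate started at `- M` bounds `F` on the whole interval by its value there and the
    -- width `2 M`.
    derivative-by-estimate : ∀ {F G} maxG K → 0# ≤ K → (∀ t → ∣ G t ∣≤ maxG) →
      (∀ s t → s ≤ t → ∣ F t - F s - G s * (t - s) ∣≤ K * ((t - s) * (t - s))) → Derivative F G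
    derivative-by-estimate {F} {G} maxG K 0≤K boundG estimate = record
      { maxF = (1# + F (- M) * F (- M)) + maxG * (M + M) + K * ((M + M) * (M + M))
      ; maxG = maxG ; K = K ; 0≤K = 0≤K
      ; boundF = λ t t∈ →
          let h≥0 = ≤⇒0≤- (lower t∈)
              2M-h≥0 = ≤⇒0≤- (width≤2M ≤-refl (upper t∈))
          in abs-weaken
            (≤-by (0≤K ⊗ (2M-h≥0 ⊗ (0≤M ⊕ 0≤M ⊕ h≥0)))
              (solve 5 (λ e g k m h → e :+ g :* (m :+ m) :+ k :* ((m :+ m) :* (m :+ m))
                  :- (e :+ g :* (m :+ m) :+ k :* (h :* h)) := k :* ((m :+ m :- h) :* (m :+ m :+ h)))
                refl (1# + F (- M) * F (- M)) maxG K M (t - - M)))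
            (abs-resp (solve 3 (λ a b e → b :+ e :+ (a :- b :- e) := a)
                refl (F t) (F (- M)) (G (- M) * (t - - M))) refl
              (abs-+ (abs-+ (abs-1+x² (F (- M))) (abs-* (boundG (- M))
                  (abs-nonneg h≥0 (width≤2M ≤-refl (upper t∈)))))
                (estimate (- M) t (lower t∈))))
      ; boundG = λ t _ → boundG t
      ; estimate = λ s t _ s≤t _ → estimate s t s≤t
      }

    derivative-arctan : Derivative arctan κ
    derivative-arctan = derivative-by-estimate 1# 1# 0≤1 κ-bound
      (λ s t s≤t → abs-resp refl (sym (*-identityˡ _)) (arctan-estimate s t s≤t))

    derivative-L : Derivative L L′
    derivative-L = derivative-by-estimate 1# (1# + 1#) 0≤2 L′-bound (λ s t _ → L-estimate s t)

  -- (x + i)ⁿ = powRe n x + i powIm n x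
  powRe powIm : ℕ → Carrier → Carrier
  powRe 0       x = 1#
  powRe (suc n) x = x * powRe n x - powIm n x
  powIm 0       x = 0#
  powIm (suc n) x = x * powIm n x + powRe n x

  -- This is `((x + i)ⁿ - (x - i)ⁿ) / i`, and `n!` times the coefficient of `arctan x` in the n-th
  -- function.
  S : ℕ → Carrier → Carrier
  S n x = (1# + 1#) * powIm n x

  sumTo : ℕ → (ℕ → Carrier) → Carrier
  sumTo 0       g = 0#
  sumTo (suc n) g = sumTo n g + g n

  coeff : ℕ → Carrier
  coeff j = recip (a (suc j)) (a#0 (suc j))

  -- The k of the theorem is suc j here.
  α : ℕ → Carrier → Carrier
  α n x = sumTo n (λ j → coeff j * x ^ suc j * S (n ∸ j) x)

  Φ : ℕ → Carrier → Carrier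
  Φ n x = α n x + S n x * arctan x + powRe n x * L x

  1/_! : ℕ → Carrier
  1/ n ! = recip (fromNat (n !)) (n!#0 n)

  F : ℕ → Carrier → Carrier
  F n x = 1/ n ! * Φ n x

  α′ : ℕ → Carrier → Carrier
  α′ n x = sumTo n (λ j → coeff j * (fromNat (suc j) * x ^ j * S (n ∸ j) x + x ^
      suc j * (fromNat (n ∸ j) * S (n ∸ suc j) x)))

  coeff-suc : ∀ i → coeff (suc i) * fromNat (suc (suc i)) * fromNat (suc i) ≈ 1#
  coeff-suc i = begin
    coeff (suc i) * fromNat (suc (suc i)) * fromNat (suc i)     ≈⟨ *-assoc _ _ _ ⟩
    coeff (suc i) * (fromNat (suc (suc i)) * fromNat (suc i))   ≈⟨ *-congˡ
        (×1-homo-* (suc (suc i)) (suc i)) ⟨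
    coeff (suc i) * a (suc (suc i))                             ≈⟨ *-comm _ _ ⟩
    a (suc (suc i)) * coeff (suc i)                             ≈⟨ *-recip _ _ ⟩
    1#                                                          ∎

  ρ : ℕ → Carrier
  ρ i = recip (fromNat (suc i)) (pos⇒#0 (fromNat-pos (suc i)))

  -- With `k = i + 2` and `a_k = k (k - 1)`: `k / a_k = 1 / (k - 1)`, and in `coeff-ρ′` likewise
  -- `(k - 1) / a_k = 1 / k`. The neighbouring boundary terms therefore match.
  coeff-ρ : ∀ i → coeff (suc i) * fromNat (suc (suc i)) ≈ ρ i
  coeff-ρ i = inverse-unique (trans (*-comm _ _) (coeff-suc i)) (*-recip (fromNat (suc i)) _)

  coeff-ρ′ : ∀ i → coeff (suc i) * fromNat (suc i) ≈ ρ (suc i)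
  coeff-ρ′ i = inverse-unique
    (trans (solve 3 (λ c m n → m :* (c :* n) := c :* m :* n)
        refl (coeff (suc i)) (fromNat (suc (suc i))) (fromNat (suc i))) (coeff-suc i))
    (*-recip (fromNat (suc (suc i))) _)

  coeff-0 : coeff 0 ≈ - 1#
  coeff-0 = inverse-unique (*-recip (- 1#) _) (solve 0 (:- :1 :* (:- :1) := :1) refl)

  ρ-0 : ρ 0 ≈ 1#
  ρ-0 = inverse-unique (*-recip (fromNat 1) _) (solve 0 ((:1 :+ :0) :* :1 := :1) refl)

  -- As a_{k+1} = k (k + 1), the k-th terms of α_n′ and n α_{n-1} differ by
  -- consecutive values of x^k / k · S_{n-k}.
  telescope : ∀ m i x → i ℕ.≤ m →
    sumTo (suc i) (λ j → coeff j * (fromNat (suc j) * x ^ j * S (suc m ∸ j) x + x ^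
        suc j * (fromNat (suc m ∸ j) * S (m ∸ j) x)))
    ≈ (- S (suc m) x + x * S m x - x ^ suc i * ρ i * S (m ∸ i) x)
      + fromNat (suc m) * sumTo (suc i) (λ j → coeff j * x ^ suc j * S (m ∸ j) x)
  -- Here the exceptional `a_1 = -1` supplies `- S (suc m) x`. The term `x * S m x` is added to
  -- offset the boundary term for `i = 0`.
  telescope m 0 x _ = begin
    0# + coeff 0 * ((1# + 0#) * 1# * S (suc m) x + x * 1# * (n * S m x))
      ≈⟨ solve 5 (λ c x n s t → :0 :+ c :* ((:1 :+ :0) :* :1 :* s :+ x :* :1 :* (n :* t))
          := (c :* s :+ x :* t :- x :* :1 :* :1 :* t) :+ n :* (:0 :+ c :* (x :* :1) :* t))
           refl (coeff 0) x n (S (suc m) x) (S m x) ⟩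
    (coeff 0 * S (suc m) x + x * S m x - x * 1# * 1# * S m x) + n * (0# + coeff 0 * (x * 1#) * S m x)
      ≈⟨ +-congʳ (+-cong (+-congʳ (trans (*-congʳ coeff-0) (solve 1 (λ s → (:- :1) :* s := :- s)
          refl _))) (-‿cong (*-congʳ (*-congˡ (sym ρ-0))))) ⟩
    (- S (suc m) x + x * S m x - x * 1# * ρ 0 * S m x) + n * (0# + coeff 0 * (x * 1#) * S m x) ∎
    where
    n = fromNat (suc m)
  telescope m (suc i) x i<m = begin
    sumTo (suc i) _ + c′ * (N″ * X * s + x * X * (d * t))
      ≈⟨ +-congʳ (telescope m i x (ℕ.<⇒≤ i<m)) ⟩
    (b - X * ρ i * s + n * Σ) + c′ * (N″ * X * s + x * X * (d * t))
      ≈⟨ +-congʳ (+-congʳ (+-congˡ (-‿cong (*-congʳ (*-congˡ (coeff-ρ i)))))) ⟨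
    (b - X * (c′ * N″) * s + n * Σ) + c′ * (N″ * X * s + x * X * (d * t))
      ≈⟨ solve 9 (λ b X c′ N s t x d e → b :- X :* (c′ :* N) :* s :+ e
          :+ c′ :* (N :* X :* s :+ x :* X :* (d :* t)) := b :+ c′ :* d :* (x :* X) :* t :+ e)
           refl b X c′ N″ s t x d (n * Σ) ⟩
    b + c′ * d * (x * X) * t + n * Σ
      -- Write `d` as `(d + N′) - N′`. Since `d + N′ = n`, the first part is `n` times the new
      -- summand of `α m`; the second becomes the next boundary term through `c′ N′ = ρ (suc i)`.
      ≈⟨ solve 8 (λ b X c′ N t x d e → b :+ c′ :* d :* (x :* X) :* t :+ e
          := b :- x :* X :* (c′ :* N) :* t :+ e :+ (d :+ N) :* (c′ :* (x :* X) :* t))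
           refl b X c′ N′ t x d (n * Σ) ⟩
    b - x * X * (c′ * N′) * t + n * Σ + (d + N′) * (c′ * (x * X) * t)
      ≈⟨ +-cong (+-congʳ (+-congˡ (-‿cong (*-congʳ (*-congˡ (coeff-ρ′ i)))))) (*-congʳ d+N′≈n) ⟩
    b - x * X * ρ (suc i) * t + n * Σ + n * (c′ * (x * X) * t)
      ≈⟨ solve 4 (λ b n e g → b :+ n :* e :+ n :* g := b :+ n :* (e :+ g))
          refl (b - x * X * ρ (suc i) * t) n Σ (c′ * (x * X) * t) ⟩
    b - x * X * ρ (suc i) * t + n * (Σ + c′ * (x * X) * t) ∎
    where
    b = - S (suc m) x + x * S m x
    X = x ^ suc i
    s = S (m ∸ i) x
    t = S (m ∸ suc i) x
    c′ = coeff (suc i)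
    n = fromNat (suc m)
    N″ = fromNat (suc (suc i))
    N′ = fromNat (suc i)
    d = fromNat (m ∸ i)
    Σ = sumTo (suc i) (λ j → coeff j * x ^ suc j * S (m ∸ j) x)
    d+N′≈n : d + N′ ≈ n
    d+N′≈n = begin
      fromNat (m ∸ i) + fromNat (suc i)   ≈⟨ ×-homo-+ 1# (m ∸ i) (suc i) ⟨
      fromNat (m ∸ i ℕ.+ suc i)           ≡⟨ ≡.cong fromNat
          (≡.trans (ℕ.+-suc (m ∸ i) i) (≡.cong suc (ℕ.m∸n+n≡m (ℕ.<⇒≤ i<m)))) ⟩
      fromNat (suc m)                     ∎

  S[n∸n]≈0 : ∀ n x → S (n ∸ n) x ≈ 0#
  S[n∸n]≈0 n x rewrite ℕ.n∸n≡0 n = zeroʳ _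

  -- At `i = m` the boundary term and the surplus last summand both contain `S 0`, which is 0. The
  -- rest, `- S (suc m) x + x * S m x`, is `- 2 powRe m x` by the recursion for `powIm`.
  α′-suc : ∀ m x → α′ (suc m) x ≈ - ((1# + 1#) * powRe m x) + fromNat (suc m) * α m x
  α′-suc m x = begin
    α′ (suc m) x
      ≈⟨ telescope m m x ℕ.≤-refl ⟩
    (- S (suc m) x + x * S m x - x ^ suc m * ρ m * S (m ∸ m) x) + fromNat
        (suc m) * (α m x + coeff m * x ^ suc m * S (m ∸ m) x)
      ≈⟨ +-cong (+-congˡ (-‿cong (trans (*-congˡ (S[n∸n]≈0 m x)) (zeroʳ _))))
          (*-congˡ (+-congˡ (trans (*-congˡ (S[n∸n]≈0 m x)) (zeroʳ _)))) ⟩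
    (- S (suc m) x + x * S m x - 0#) + fromNat (suc m) * (α m x + 0#)
      ≈⟨ solve 5 (λ x r i n A → (:- (:2 :* (x :* i :+ r)) :+ x :* (:2 :* i) :- :0) :+ n :* (A :+ :0)
          := :- (:2 :* r) :+ n :* A)
           refl x (powRe m x) (powIm m x) (fromNat (suc m)) (α m x) ⟩
    - ((1# + 1#) * powRe m x) + fromNat (suc m) * α m x ∎

  module Derivatives (M : Carrier) (0≤M : 0# ≤ M) where

    open Differentiation M 0≤M public

    -- The common form of `z (m z^(m-1)) = m z^m` for real and imaginary parts. At `m = 0` the value
    -- at `pred 0 = 0` is annihilated by `fromNat 0`.
    predecessor-step : ∀ (g h : ℕ → Carrier → Carrier) → (∀ m x → g (suc m) x ≈ x * g m x + h m x) →
        ∀ m x →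
      x * (fromNat m * g (pred m) x) + fromNat m * h (pred m) x ≈ fromNat m * g m x
    predecessor-step g h step 0       x = solve 3 (λ x a b → x :* (:0 :* a) :+ :0 :* b := :0 :* a)
        refl x (g 0 x) (h 0 x)
    predecessor-step g h step (suc m) x = trans
      (solve 4 (λ x n a b → x :* (n :* a) :+ n :* b := n :* (x :* a :+ b))
          refl x (fromNat (suc m)) (g m x) (h m x))
      (*-congˡ (sym (step m x)))

    derivative-powRe : ∀ n → Derivative (powRe n) (λ x → fromNat n * powRe (pred n) x)
    derivative-powIm : ∀ n → Derivative (powIm n) (λ x → fromNat n * powIm (pred n) x)

    derivative-powRe 0       = derivative-resp (λ _ → refl) (λ _ → sym (zeroˡ _)) (derivative-const 1#)
    derivative-powRe (suc m) = derivative-resp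
      (λ x → solve 2 (λ u v → u :+ (:- :1) :* v := u :- v) refl (x * powRe m x) (powIm m x))
      (λ x → trans
        (solve 4 (λ r u n v → :1 :* r :+ u :+ (:- :1) :* (n :* v) := r :+ (u :+ n :* (:- v))) refl
          (powRe m x) (x * (fromNat m * powRe (pred m) x)) (fromNat m) (powIm (pred m) x))
        (trans (+-congˡ (predecessor-step powRe (λ m x → - powIm m x) (λ _ _ → refl) m x))
          (solve 2 (λ r n → r :+ n :* r := (:1 :+ n) :* r) refl (powRe m x) (fromNat m))))
      (derivative-+ (derivative-* derivative-id (derivative-powRe m))
          (derivative-scale (- 1#) (derivative-powIm m)))

    derivative-powIm 0       = derivative-resp (λ _ → refl) (λ _ → sym (zeroˡ _)) (derivative-const 0#)
    derivative-powIm (suc m) = derivative-resp (λ _ → refl)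
      (λ x → trans (+-assoc _ _ _)
        (trans (+-congˡ (predecessor-step powIm powRe (λ _ _ → refl) m x))
          (solve 2 (λ r n → :1 :* r :+ n :* r := (:1 :+ n) :* r) refl (powIm m x) (fromNat m))))
      (derivative-+ (derivative-* derivative-id (derivative-powIm m)) (derivative-powRe m))

    derivative-S : ∀ n → Derivative (S n) (λ x → fromNat n * S (pred n) x)
    derivative-S n = derivative-resp (λ _ → refl)
      (λ x → solve 2 (λ n r → :2 :* (n :* r) := n :* (:2 :* r)) refl (fromNat n) (powIm (pred n) x))
      (derivative-scale (1# + 1#) (derivative-powIm n))

    derivative-pow : ∀ k → Derivative (λ x → x ^ suc k) (λ x → fromNat (suc k) * x ^ k)
    derivative-pow 0       = derivative-resp (λ x → sym (*-identityʳ x)) (λ _ → solve 0 (:1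
        := (:1 :+ :0) :* :1) refl) derivative-id
    derivative-pow (suc k) = derivative-resp (λ _ → refl)
      (λ x → solve 3 (λ x n y → :1 :* (x :* y) :+ x :* ((:1 :+ n) :* y)
          := (:1 :+ (:1 :+ n)) :* (x :* y)) refl x (fromNat k) (x ^ k))
      (derivative-* derivative-id (derivative-pow k))

    derivative-sumTo : ∀ n {G H : ℕ → Carrier → Carrier} → (∀ j → Derivative (G j) (H j)) →
      Derivative (λ x → sumTo n (λ j → G j x)) (λ x → sumTo n (λ j → H j x))
    derivative-sumTo 0       D = derivative-const 0#
    derivative-sumTo (suc n) D = derivative-+ (derivative-sumTo n D) (D n)

    derivative-α : ∀ n → Derivative (α n) (α′ n)
    derivative-α n = derivative-sumTo n (λ j → derivative-resp
      (λ x → sym (*-assoc (coeff j) (x ^ suc j) (S (n ∸ j) x)))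
      (λ x → *-congˡ (+-congˡ (*-congˡ (*-congˡ (reflexive
          (≡.cong (λ k → S k x) (ℕ.pred[m∸n]≡m∸[1+n] n j)))))))
      (derivative-scale (coeff j) (derivative-* (derivative-pow j) (derivative-S (n ∸ j)))))

    -- Differentiating `arctan` and `L` contributes `2 (x i + r) κ + 2 x (x r - i) κ = 2 r (1 + x²)
    -- κ = 2 r`, with `r`, `i` the parts of `(x + i)^m`. This cancels the `- 2 r` in `α′-suc`.
    derivative-Φ : ∀ m → Derivative (Φ (suc m)) (λ x → fromNat (suc m) * Φ m x)
    derivative-Φ m = derivative-resp (λ _ → refl)
      (λ x → let n = fromNat (suc m) ; r = powRe m x ; i = powIm m x ; T = arctan x ; l = L x in begin
        α′ (suc m) x + (n * S m x * T + S (suc m) x * κ x) + (n * r * l + powRe (suc m) x * L′ x)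
          ≈⟨ +-congʳ (+-congʳ (α′-suc m x)) ⟩
        - ((1# + 1#) * r) + n * α m x + (n * S m x * T + S (suc m) x * κ x)
            + (n * r * l + powRe (suc m) x * L′ x)
          ≈⟨ solve 8 (λ x r i A n T l k →
               :- (:2 :* r) :+ n :* A :+ (n :* (:2 :* i) :* T :+ :2 :* (x :* i :+ r) :* k)
                   :+ (n :* r :* l :+ (x :* r :- i) :* ((x :+ x) :* k))
               := n :* (A :+ (:2 :* i) :* T :+ r :* l) :+ :2 :* r :* ((:1 :+ x :* x) :* k :- :1))
                   refl x r i (α m x) n T l (κ x) ⟩
        n * Φ m x + (1# + 1#) * r * (w x * κ x - 1#)
          ≈⟨ +-congˡ (trans (*-congˡ (trans (+-congʳ (wκ≈1 x)) (x-x≈0 1#))) (zeroʳ _)) ⟩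
        n * Φ m x + 0#
          ≈⟨ +-identityʳ _ ⟩
        n * Φ m x ∎)
      (derivative-+ (derivative-+ (derivative-α (suc m))
          (derivative-* (derivative-S (suc m)) derivative-arctan))
        (derivative-* (derivative-powRe (suc m)) derivative-L))

    derivative-F : ∀ m → Derivative (F (suc m)) (F m)
    derivative-F m = derivative-resp (λ _ → refl)
      (λ x → trans (sym (*-assoc _ _ _)) (*-congʳ 1/!-step))
          (derivative-scale 1/ suc m ! (derivative-Φ m))
      where
      1/!-step : 1/ suc m ! * fromNat (suc m) ≈ 1/ m !
      1/!-step = inverse-unique {x = fromNat (m !)} (begin
        fromNat (m !) * (1/ suc m ! * fromNat (suc m))   ≈⟨ solve 3 (λ u r n → u :* (r :* n)
            := n :* u :* r) refl (fromNat (m !)) 1/ suc m ! (fromNat (suc m)) ⟩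
        fromNat (suc m) * fromNat (m !) * 1/ suc m !     ≈⟨ *-congʳ (×1-homo-* (suc m) (m !)) ⟨
        fromNat (suc m !) * 1/ suc m !                   ≈⟨ *-recip _ _ ⟩
        1#                                               ∎) (*-recip _ _)

  -- `w 0#` is 1 only up to `≈`. On the interval from 1 to `w 0#`, where all widths are 0, a
  -- constant function satisfies the estimate of the fundamental theorem with `K = 0`.
  L-0 : L 0# ≈ 0#
  L-0 = trans (fundamental-theorem {g = λ t 1≤t _ → recip t (pos⇒#0 (<-≤-trans 0<1 1≤t))} (1≤w 0#)
      (proj₁ (ln-integral (w 0#) (0<1+x² 0#)) (1≤w 0#)) (λ _ → 0#) ≤-refl
      (λ s t 1≤s s≤t t≤w → abs-resp
        (trans (solve 0 (:0 := :0 :- :0 :- :0) refl) (+-congˡ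
            (-‿cong (sym (trans (*-congˡ (t-s≈0 1≤s s≤t t≤w)) (zeroʳ _))))))
        (sym (zeroˡ _)) (abs-0 ≤-refl)))
    (x-x≈0 0#)
    where
    t-s≈0 : ∀ {s t} → 1# ≤ s → s ≤ t → t ≤ w 0# → t - s ≈ 0#
    t-s≈0 {s} 1≤s s≤t t≤w = trans (+-congʳ (≤-antisym
      (≤-trans (≤-trans t≤w (≈⇒≤ (solve 0 (:1 :+ :0 :* :0 := :1) refl))) 1≤s) s≤t)) (x-x≈0 s)

  sumTo-cong : ∀ n {g h} → (∀ j → g j ≈ h j) → sumTo n g ≈ sumTo n h
  sumTo-cong 0       g≈h = refl
  sumTo-cong (suc n) g≈h = +-cong (sumTo-cong n g≈h) (g≈h n)

  sumTo-0 : ∀ n → sumTo n (λ _ → 0#) ≈ 0#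
  sumTo-0 0       = refl
  sumTo-0 (suc n) = trans (+-congʳ (sumTo-0 n)) (+-identityˡ 0#)

  α-0 : ∀ n → α n 0# ≈ 0#
  α-0 n = trans (sumTo-cong n (λ j → solve 3 (λ c y s → c :* (:0 :* y) :* s := :0)
      refl (coeff j) (0# ^ j) (S (n ∸ j) 0#))) (sumTo-0 n)

  F-0 : ∀ n → F n 0# ≈ 0#
  F-0 n = trans (*-congˡ (trans (+-cong (+-cong (α-0 n) (trans (*-congˡ arctan-0) (zeroʳ _)))
      (trans (*-congˡ L-0) (zeroʳ _)))
    (solve 0 (:0 :+ :0 :+ :0 := :0) refl))) (zeroʳ _)

  F-first : ∀ x → F 0 x ≈ L x
  F-first x = begin
    1/ 0 ! * (0# + (1# + 1#) * 0# * arctan x + 1# * L x)   ≈⟨ *-congʳ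
        (inverse-unique (*-recip (fromNat 1) _) (solve 0 ((:1 :+ :0) :* :1 := :1) refl)) ⟩
    1# * (0# + (1# + 1#) * 0# * arctan x + 1# * L x)       ≈⟨ solve 2 (λ T l →
        :1 :* (:0 :+ :2 :* :0 :* T :+ :1 :* l) := l) refl (arctan x) (L x) ⟩
    L x                                                    ∎

  iterated-integral : (f : ℕ → Carrier → Carrier) → (∀ x → f 0 x ≈ L x) →
      (∀ n x → IsIntegral 0# x (f n) (f (suc n) x)) →
    ∀ n x → f n x ≈ F n x
  iterated-integral f f₀ f-integral 0       x = trans (f₀ x) (sym (F-first x))
  iterated-integral f f₀ f-integral (suc n) x = begin
    f (suc n) x               ≈⟨ integral-fundamental {g = f n} (abs-1+x² x) (f-integral n x)
        (F (suc n)) (0≤K D)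
                                   (λ s t p q r → abs-resp
                                       (+-congˡ (-‿cong (*-congʳ
                                       (sym (iterated-integral f f₀ f-integral n s)))))
                                       refl (estimate D s t p q r)) ⟩
    F (suc n) x - F (suc n) 0#  ≈⟨ +-congˡ (-‿cong (F-0 (suc n))) ⟩
    F (suc n) x - 0#          ≈⟨ solve 1 (λ y → y :- :0 := y) refl (F (suc n) x) ⟩
    F (suc n) x               ∎
    where
    -- The bound `M = 1 + x²` makes `[- M , M]` contain both 0 and `x`, whatever the sign of `x`.
    open Derivatives (1# + x * x) (0≤1 ⊕ 0≤x² x)
    open Derivative
    D = derivative-F n

-- Uniqueness of the decomposition and the two closed forms

module ClosedForm {c ℓ₁ ℓ₂} (ℝ : RealField c ℓ₁ ℓ₂) (E : ElementaryFunctions ℝ) where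

  open Analysis ℝ
  open ElementaryFunctions E
  open OrderedField ℝ
  open LogArctan ℝ E
  open Independence ℝ E
  open Antiderivatives ℝ E
  open IntegerCoefficients commutativeRing
    using (solve; _:=_; _:+_; _:*_; _:-_; :-_; :0; :1; :2)
  open Relation.Binary.Reasoning.Setoid setoid

  below-resp : ∀ {d P Q} → (∀ x → P x ≈ Q x) → PolynomialBelow d P → PolynomialBelow d Q
  below-resp P≈Q (vanishing P≈0)          = vanishing (λ x → trans (sym (P≈Q x)) (P≈0 x))
  below-resp P≈Q (leading p P≈ P′-poly)   = leading p (λ x → trans (sym (P≈Q x)) (P≈ x)) P′-poly

  below-weaken : ∀ k {d P} → PolynomialBelow d P → PolynomialBelow (k ℕ.+ d) P
  below-weaken 0       P-poly = P-poly
  below-weaken (suc k) P-poly = leading 0# (λ x → sym (trans (+-congʳ (zeroˡ _)) (+-identityˡ _)))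
      (below-weaken k P-poly)

  below-+ : ∀ {d P Q} → PolynomialBelow d P → PolynomialBelow d Q → PolynomialBelow d (λ x → P x + Q x)
  below-+ (vanishing P≈0) (vanishing Q≈0) = vanishing (λ x →
      trans (+-cong (P≈0 x) (Q≈0 x)) (+-identityˡ 0#))
  below-+ (leading {d} {Q = P′} p P≈ P-poly) (leading {Q = Q′} q Q≈ Q-poly) = leading (p + q)
    (λ x → trans (+-cong (P≈ x) (Q≈ x))
      (solve 5 (λ p q y u v → p :* y :+ u :+ (q :* y :+ v) := (p :+ q) :* y :+ (u :+ v))
          refl p q (x ^ d) (P′ x) (Q′ x)))
    (below-+ P-poly Q-poly)

  below-scale : ∀ k {d P} → PolynomialBelow d P → PolynomialBelow d (λ x → k * P x)
  below-scale k (vanishing P≈0)        = vanishing (λ x → trans (*-congˡ (P≈0 x)) (zeroʳ k))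
  below-scale k (leading {d} {Q = P′} p P≈ P-poly) = leading (k * p)
    (λ x → trans (*-congˡ (P≈ x)) (solve 4 (λ k p y u → k :* (p :* y :+ u) := k :* p :* y :+ k :* u)
        refl k p (x ^ d) (P′ x)))
    (below-scale k P-poly)

  below-x : ∀ {d P} → PolynomialBelow d P → PolynomialBelow (suc d) (λ x → x * P x)
  below-x (vanishing P≈0) = below-weaken 1 (vanishing (λ x → trans (*-congˡ (P≈0 x)) (zeroʳ x)))
  below-x (leading {d} {Q = P′} p P≈ P-poly) = leading p
    (λ x → trans (*-congˡ (P≈ x)) (solve 4 (λ x p y u → x :* (p :* y :+ u)
        := p :* (x :* y) :+ x :* u) refl x p (x ^ d) (P′ x)))
    (below-x P-poly)

  -- A property of functions rather than a coefficient list: independence speaks of values, and `α`,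
  -- `S` and `powRe` are defined as functions.
  IsPolynomial : (Carrier → Carrier) → Set (c ⊔ ℓ₁)
  IsPolynomial P = ∃[ d ] PolynomialBelow d P

  polynomial-resp : ∀ {P Q} → (∀ x → P x ≈ Q x) → IsPolynomial P → IsPolynomial Q
  polynomial-resp P≈Q (d , P-poly) = d , below-resp P≈Q P-poly

  polynomial-+ : ∀ {P Q} → IsPolynomial P → IsPolynomial Q → IsPolynomial (λ x → P x + Q x)
  polynomial-+ {P} (d , P-poly) (e , Q-poly) =
    d ℕ.+ e , below-+ (≡.subst (λ k → PolynomialBelow k P) (ℕ.+-comm e d) (below-weaken e P-poly))
        (below-weaken d Q-poly)

  polynomial-scale : ∀ k {P} → IsPolynomial P → IsPolynomial (λ x → k * P x)
  polynomial-scale k (d , P-poly) = d , below-scale k P-poly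

  polynomial-x : ∀ {P} → IsPolynomial P → IsPolynomial (λ x → x * P x)
  polynomial-x (d , P-poly) = suc d , below-x P-poly

  polynomial-const : ∀ k → IsPolynomial (λ _ → k)
  polynomial-const k = 1 , leading k (λ _ → solve 1 (λ k → k := k :* :1 :+ :0)
      refl k) (vanishing (λ _ → refl))

  polynomial-eval : ∀ p → IsPolynomial (λ x → p ⟨ x ⟩)
  polynomial-eval []      = polynomial-const 0#
  polynomial-eval (k ∷ p) = polynomial-+ (polynomial-const k) (polynomial-x (polynomial-eval p))

  polynomial-powRe : ∀ n → IsPolynomial (powRe n)
  polynomial-powIm : ∀ n → IsPolynomial (powIm n)
  polynomial-powRe 0       = polynomial-const 1#
  polynomial-powRe (suc n) = polynomial-resp (λ x → solve 2 (λ u v → u :+ (:- :1) :* v := u :- v)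
      refl (x * powRe n x) (powIm n x))
    (polynomial-+ (polynomial-x (polynomial-powRe n)) (polynomial-scale (- 1#) (polynomial-powIm n)))
  polynomial-powIm 0       = polynomial-const 0#
  polynomial-powIm (suc n) = polynomial-+ (polynomial-x (polynomial-powIm n)) (polynomial-powRe n)

  polynomial-pow-* : ∀ k {P} → IsPolynomial P → IsPolynomial (λ x → x ^ k * P x)
  polynomial-pow-* 0       P-poly = polynomial-resp (λ x → sym (*-identityˡ _)) P-poly
  polynomial-pow-* (suc k) P-poly = polynomial-resp (λ x → sym (*-assoc _ _ _))
      (polynomial-x (polynomial-pow-* k P-poly))

  polynomial-sumTo : ∀ n {G : ℕ → Carrier → Carrier} → (∀ j → IsPolynomial (G j)) →
      IsPolynomial (λ x → sumTo n (λ j → G j x))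
  polynomial-sumTo 0       G-poly = polynomial-const 0#
  polynomial-sumTo (suc n) G-poly = polynomial-+ (polynomial-sumTo n G-poly) (G-poly n)

  polynomial-S : ∀ n → IsPolynomial (S n)
  polynomial-S n = polynomial-scale (1# + 1#) (polynomial-powIm n)

  polynomial-α : ∀ n → IsPolynomial (α n)
  polynomial-α n = polynomial-sumTo n (λ j → polynomial-resp (λ x → sym (*-assoc _ _ _))
    (polynomial-scale (coeff j) (polynomial-pow-* (suc j) (polynomial-S (n ∸ j)))))

  polynomial-independence : ∀ {P Q R} → IsPolynomial P → IsPolynomial Q → IsPolynomial R →
    (∀ x → P x + Q x * arctan x + R x * L x ≈ 0#) → (∀ x → P x ≈ 0#) × (∀ x → Q x ≈ 0#)
  polynomial-independence {Q = Q} {R} (d , P-poly) (e , Q-poly) (k , R-poly) =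
      independence (k ℕ.+ (e ℕ.+ d))
    (below-weaken k (below-weaken e P-poly))
    (below-weaken k (≡.subst (λ m → PolynomialBelow m Q) (ℕ.+-comm d e) (below-weaken d Q-poly)))
    (≡.subst (λ m → PolynomialBelow m R) (ℕ.+-comm (e ℕ.+ d) k) (below-weaken (e ℕ.+ d) R-poly))

  decomposition-unique : ∀ {A B C A′ B′ C′} →
    IsPolynomial A → IsPolynomial B → IsPolynomial C → IsPolynomial A′ → IsPolynomial B′ →
        IsPolynomial C′ →
    (∀ x → A x + B x * arctan x + C x * L x ≈ A′ x + B′ x * arctan x + C′ x * L x) →
    (∀ x → A x ≈ A′ x) × (∀ x → B x ≈ B′ x)
  decomposition-unique {A} {B} {C} {A′} {B′} {C′} A-poly B-poly C-poly A′-poly B′-poly C′-poly eq =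
    (λ x → difference (proj₁ vanish x)) , (λ x → difference (proj₂ vanish x))
    where
    difference : ∀ {u v} → u + (- 1#) * v ≈ 0# → u ≈ v
    difference {u} {v} eq = trans (solve 2 (λ u v → u := u :+ (:- :1) :* v :+ v)
        refl u v) (trans (+-congʳ eq) (+-identityˡ v))
    minus : ∀ {P Q} → IsPolynomial P → IsPolynomial Q → IsPolynomial (λ x → P x + (- 1#) * Q x)
    minus P-poly Q-poly = polynomial-+ P-poly (polynomial-scale (- 1#) Q-poly)
    vanish = polynomial-independence (minus A-poly A′-poly) (minus B-poly B′-poly)
        (minus C-poly C′-poly)
      (λ x → trans
        (solve 8 (λ a b c a′ b′ c′ T l → a :+ (:- :1) :* a′ :+ (b :+ (:- :1) :* b′) :* T
            :+ (c :+ (:- :1) :* c′) :* l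
             := (a :+ b :* T :+ c :* l) :- (a′ :+ b′ :* T :+ c′ :* l))
                 refl (A x) (B x) (C x) (A′ x) (B′ x) (C′ x) (arctan x) (L x))
        (trans (+-congʳ (eq x)) (x-x≈0 _)))

  sumTo-front : ∀ n g → sumTo (suc n) g ≈ g 0 + sumTo n (λ j → g (suc j))
  sumTo-front 0       g = +-comm 0# (g 0)
  sumTo-front (suc n) g = trans (+-congʳ (sumTo-front n g)) (+-assoc _ _ _)

  sum≈sumTo : ∀ {n} (f : Fin n → Carrier) g → (∀ j → f j ≈ g (toℕ j)) → sum f ≈ sumTo n g
  sum≈sumTo {0}     f g f≈g = refl
  sum≈sumTo {suc n} f g f≈g = trans
    (+-cong (f≈g Fin.zero) (sum≈sumTo (λ j → f (Fin.suc j)) (λ j → g (suc j)) (λ j → f≈g (Fin.suc j))))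
    (sym (sumTo-front n g))

  sumᶜ≈sumTo : ∀ {n} (f : Fin n → ℂ) g → (∀ j → f j ≈ᶜ 0# +i g (toℕ j)) → sumᶜ f ≈ᶜ 0# +i sumTo n g
  sumᶜ≈sumTo {0}     f g f≈g = refl , refl
  sumᶜ≈sumTo {suc n} f g f≈g with sumᶜ≈sumTo (λ j → f (Fin.suc j)) (λ j → g (suc j)) (λ j →
      f≈g (Fin.suc j))
  ... | re≈ , im≈ = trans (+-cong (proj₁ (f≈g Fin.zero)) re≈) (+-identityˡ 0#)
                  , trans (+-cong (proj₂ (f≈g Fin.zero)) im≈) (sym (sumTo-front n g))

  [x+i]^ : ∀ x n → (ofReal x +ᶜ 𝕚) ^ᶜ n ≈ᶜ powRe n x +i powIm n x
  [x+i]^ x 0       = refl , refl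
  [x+i]^ x (suc n) with [x+i]^ x n
  ... | re≈ , im≈ =
      trans (+-cong (*-congˡ re≈) (-‿cong (*-congˡ im≈)))
          (solve 3 (λ x r i → (x :+ :0) :* r :- (:0 :+ :1) :* i := x :* r :- i)
          refl x (powRe n x) (powIm n x))
    , trans (+-cong (*-congˡ im≈) (*-congˡ re≈)) (solve 3 (λ x r i →
        (x :+ :0) :* i :+ (:0 :+ :1) :* r := x :* i :+ r) refl x (powRe n x) (powIm n x))

  [x-i]^ : ∀ x n → (ofReal x -ᶜ 𝕚) ^ᶜ n ≈ᶜ powRe n x +i (- powIm n x)
  [x-i]^ x 0       = refl , solve 0 (:0 := :- :0) refl
  [x-i]^ x (suc n) with [x-i]^ x n
  ... | re≈ , im≈ =
      trans (+-cong (*-congˡ re≈) (-‿cong (*-congˡ im≈)))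
          (solve 3 (λ x r i → (x :+ :- :0) :* r :- (:0 :+ :- :1) :* :- i := x :* r :- i)
          refl x (powRe n x) (powIm n x))
    , trans (+-cong (*-congˡ im≈) (*-congˡ re≈)) (solve 3 (λ x r i →
        (x :+ :- :0) :* :- i :+ (:0 :+ :- :1) :* r := :- (x :* i :+ r)) refl x (powRe n x) (powIm n x))

  conjugate-difference : ∀ y x n → ofReal y *ᶜ ((ofReal x +ᶜ 𝕚) ^ᶜ n -ᶜ (ofReal x -ᶜ 𝕚) ^ᶜ n) ≈ᶜ 0#
      +i (y * S n x)
  conjugate-difference y x n with [x+i]^ x n | [x-i]^ x n
  ... | re≈ , im≈ | re′≈ , im′≈ =
      trans (+-cong (*-congˡ (+-cong re≈ (-‿cong re′≈))) (-‿cong (zeroˡ _)))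
          (solve 2 (λ y r → y :* (r :- r) :- :0 := :0) refl y (powRe n x))
    , trans (+-cong (*-congˡ (+-cong im≈ (-‿cong im′≈))) (zeroˡ _))
        (solve 2 (λ y i → y :* (i :- :- i) :+ :0 := y :* (:2 :* i)) refl y (powIm n x))

  -- `1 / (i r) = - i / r`. The reciprocal is the conjugate times `q = 1 / |i r|²`, and
  -- `|i r|² = r²` makes `r q` an inverse of `r`.
  recipᶜ-i*n! : ∀ n → recipᶜ (𝕚 *ᶜ ofReal (fromNat (n !))) (i*n!≠0 n) ≈ᶜ 0# +i (- 1/ n !)
  recipᶜ-i*n! n =
      trans (*-congʳ (solve 1 (λ r → :0 :* r :- :1 :* :0 := :0) refl r)) (zeroˡ _)
    , trans (solve 2 (λ r q → :- (:0 :* :0 :+ :1 :* r) :* q := :- (r :* q)) refl r q)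
        (-‿cong (inverse-unique {x = r} (begin
          r * (r * q)          ≈⟨ solve 2 (λ r q → r :* (r :* q)
              := ((:0 :* r :- :1 :* :0) :* (:0 :* r :- :1 :* :0)
              :+ (:0 :* :0 :+ :1 :* r) :* (:0 :* :0 :+ :1 :* r)) :* q) refl r q ⟩
          ∣ 𝕚 *ᶜ ofReal r ∣² * q   ≈⟨ *-recip _ _ ⟩
          1#                   ∎) (*-recip r _)))
    where
    r = fromNat (n !)
    q = recip ∣ 𝕚 *ᶜ ofReal r ∣² (i*n!≠0 n)

  -- With `k = j + 1` the exponent `n - k + 1` is `n - j`; truncation does not interfere because
  -- `j < n`.
  [n∸1+j]+1 : ∀ {n} (j : Fin n) → n ∸ suc (toℕ j) ℕ.+ 1 ≡.≡ n ∸ toℕ j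
  [n∸1+j]+1 {n} j = ≡.trans (ℕ.+-comm _ 1) (≡.sym (ℕ.+-∸-assoc 1 (Fin.toℕ<n j)))

  *ᶜ-imaginary : ∀ {z z′ r s} → z ≈ᶜ 0# +i (- r) → z′ ≈ᶜ 0# +i s → ofReal (r * s) ≈ᶜ z *ᶜ z′
  *ᶜ-imaginary {r = r} {s} (re≈ , im≈) (re′≈ , im′≈) =
      sym (trans (+-cong (*-cong re≈ re′≈) (-‿cong (*-cong im≈ im′≈)))
          (solve 2 (λ r s → :0 :* :0 :- (:- r) :* s := r :* s) refl r s))
    , sym (trans (+-cong (*-cong re≈ im′≈) (*-cong im≈ re′≈))
        (solve 2 (λ r s → :0 :* s :+ (:- r) :* :0 := :0) refl r s))

  α-complex : ∀ n x → ofReal (1/ n ! * α n x) ≈ᶜ recipᶜ (𝕚 *ᶜ ofReal (fromNat (n !))) (i*n!≠0 n)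
    *ᶜ sumᶜ (λ (j : Fin n) → let k = suc (toℕ j) in
         ofReal (x ^ k * recip (a k) (a#0 k)) *ᶜ ((ofReal x +ᶜ 𝕚) ^ᶜ (n ∸ k ℕ.+ 1) -ᶜ
             (ofReal x -ᶜ 𝕚) ^ᶜ (n ∸ k ℕ.+ 1)))
  α-complex n x = *ᶜ-imaginary (recipᶜ-i*n! n) (sumᶜ≈sumTo {n} _ (λ j →
      coeff j * x ^ suc j * S (n ∸ j) x) (λ j →
      let re≈ , im≈ = conjugate-difference (x ^ suc (toℕ j) * coeff (toℕ j)) x (n ∸ suc (toℕ j) ℕ.+ 1)
      in re≈ , trans im≈ (*-cong (*-comm _ _) (reflexive (≡.cong (λ m → S m x) ([n∸1+j]+1 j))))))

  -- The factor `(n - k + 1)!` cancels the denominator of `B` and leaves `S`, so that the summands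
  -- become those of `α`.
  α-real : ∀ n x (B : ℕ → Carrier) → (∀ m → B m ≈ 1/ m ! * S m x) →
    1/ n ! * α n x ≈ 1/ n ! * sum (λ (j : Fin n) → let k = suc (toℕ j) in
      fromNat ((n ∸ k ℕ.+ 1) !) * recip (a k) (a#0 k) * x ^ k * B (n ∸ k ℕ.+ 1))
  α-real n x B B≈ = *-congˡ (sym (sum≈sumTo {n} _ (λ j → coeff j * x ^ suc j * S (n ∸ j) x) (λ j →
    let m = n ∸ suc (toℕ j) ℕ.+ 1 ; q = coeff (toℕ j) ; y = x ^ suc (toℕ j) in begin
      fromNat (m !) * q * y * B m                      ≈⟨ *-congˡ (B≈ m) ⟩
      fromNat (m !) * q * y * (1/ m ! * S m x)         ≈⟨ solve 5 (λ u q y r s →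
          u :* q :* y :* (r :* s) := u :* r :* (q :* y :* s)) refl (fromNat (m !)) q y 1/ m ! (S m x) ⟩
      fromNat (m !) * 1/ m ! * (q * y * S m x)         ≈⟨ trans (*-congʳ (*-recip _ _))
          (*-identityˡ _) ⟩
      q * y * S m x                                    ≈⟨ *-congˡ
          (reflexive (≡.cong (λ m → S m x) ([n∸1+j]+1 j))) ⟩
      q * y * S (n ∸ toℕ j) x                          ∎)))

  coefficients : (f : ℕ → Carrier → Carrier) → (∀ x → f 0 x ≈ L x) →
      (∀ n x → IsIntegral 0# x (f n) (f (suc n) x)) →
    (A B C : ℕ → Polynomial) → (∀ n x → f n x ≈ A n ⟨ x ⟩ + B n ⟨ x ⟩ * arctan x + C n ⟨ x ⟩ * L x) →
    ∀ n → (∀ x → A n ⟨ x ⟩ ≈ 1/ n ! * α n x) × (∀ x → B n ⟨ x ⟩ ≈ 1/ n ! * S n x)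
  coefficients f f₀ f-integral A B C decomposition n = decomposition-unique
    (polynomial-eval (A n)) (polynomial-eval (B n)) (polynomial-eval (C n))
    (polynomial-scale 1/ n ! (polynomial-α n)) (polynomial-scale 1/ n ! (polynomial-S n))
        (polynomial-scale 1/ n ! (polynomial-powRe n))
    (λ x → trans (sym (decomposition n x)) (trans (iterated-integral f f₀ f-integral n x)
      (solve 6 (λ r A S T R l → r :* (A :+ S :* T :+ R :* l) := r :* A :+ r :* S :* T :+ r :* R :* l)
        refl 1/ n ! (α n x) (S n x) (arctan x) (powRe n x) (L x))))

theorem4p6 : ∀ {c ℓ₁ ℓ₂ : Level} (ℝ : RealField c ℓ₁ ℓ₂) →
  let open Analysis ℝ in
  (ln : ∀ y → 0# < y → Carrier) →
  (∀ y (0<y : 0# < y) → IsLn y 0<y (ln y 0<y)) →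
  (arctan : Carrier → Carrier) →
  (∀ x → IsArctan x (arctan x)) →
  (f : ℕ → Carrier → Carrier) →
  (∀ x → f 0 x ≈ ln (1# + x * x) (0<1+x² x)) →
  (∀ n x → IsIntegral 0# x (f n) (f (suc n) x)) →
  (A B C : ℕ → Polynomial) →
  (∀ n x → f n x ≈ A n ⟨ x ⟩ + B n ⟨ x ⟩ * arctan x + C n ⟨ x ⟩ * ln (1# + x * x) (0<1+x² x)) →
  ∀ n → 1 ℕ.≤ n → ∀ x →
  (ofReal (A n ⟨ x ⟩)
    ≈ᶜ recipᶜ (𝕚 *ᶜ ofReal (fromNat (n !))) (i*n!≠0 n)
       *ᶜ sumᶜ (λ (j : Fin n) → let k = suc (toℕ j) in
            ofReal (x ^ k * recip (a k) (a#0 k))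
            *ᶜ ((ofReal x +ᶜ 𝕚) ^ᶜ (n ∸ k ℕ.+ 1) -ᶜ (ofReal x -ᶜ 𝕚) ^ᶜ (n ∸ k ℕ.+ 1))))
  ×
  (A n ⟨ x ⟩
    ≈ recip (fromNat (n !)) (n!#0 n)
      * sum (λ (j : Fin n) → let k = suc (toℕ j) in
          fromNat ((n ∸ k ℕ.+ 1) !) * recip (a k) (a#0 k) * x ^ k * B (n ∸ k ℕ.+ 1) ⟨ x ⟩))
theorem4p6 ℝ ln ln-integral arctan arctan-integral f f₀ f-integral A B C decomposition n _ x =
  (trans (A≈ n) (proj₁ complex) , proj₂ complex) , trans (A≈ n) (α-real n x (λ m → B m ⟨ x ⟩) B≈)
  where
  open Analysis ℝ
  E : ElementaryFunctions ℝ
  E = record { ln = ln ; ln-integral = ln-integral ; arctan = arctan ; arctan-integral =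
      arctan-integral }
  open Antiderivatives ℝ E using (1/_!; α; S)
  open ClosedForm ℝ E using (coefficients; α-complex; α-real)
  A≈ : ∀ m → A m ⟨ x ⟩ ≈ 1/ m ! * α m x
  A≈ m = proj₁ (coefficients f f₀ f-integral A B C decomposition m) x
  B≈ : ∀ m → B m ⟨ x ⟩ ≈ 1/ m ! * S m x
  B≈ m = proj₂ (coefficients f f₀ f-integral A B C decomposition m) x
  complex = α-complex n x
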